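{- Let $G$ be a finite simple graph that is $(P_6,\text{diamond})$-free. Then $\chi(G)\le \omega(G)+3$.
   Context: $P_6$ denotes the path on $6$ vertices. The diamond is the graph obtained from the complete graph $K_4$ by removing one edge. A graph $G$ is $(H_1,H_2)$-free if it contains no induced subgraph isomorphic to $H_1$ or to $H_2$. $\chi(G)$ is the chromatic number of $G$ and $\omega(G)$ is the clique number of $G$ (the size of a largest set of pairwise adjacent vertices). -}

module Defs where

open import Data.Nat using (ℕ; _≤_; _+_)
open import Data.Fin using (Fin; zero; suc)
open import Data.Bool using (Bool; true; false)
open import Data.Product using (Σ; ∃; _×_)
open import Relation.Binary.PropositionalEquality using (_≡_; _≢_)
open import Relation.Nullary using (¬_)

record Graph (n : ℕ) : Set where
  field
    adj   : Fin n → Fin n → Bool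
    sym   : ∀ u v → adj u v ≡ adj v u
    irrefl : ∀ v → adj v v ≡ false
open Graph public

_InducedIn_ : ∀ {k n} → Graph k → Graph n → Set
_InducedIn_ {k} {n} H G =
  Σ (Fin k → Fin n) λ f →
    (∀ i j → f i ≡ f j → i ≡ j) ×
    (∀ i j → adj G (f i) (f j) ≡ adj H i j)

Free : ∀ {k n} → Graph k → Graph n → Set
Free H G = ¬ (H InducedIn G)

P6adj : Fin 6 → Fin 6 → Bool
P6adj zero (suc zero) = true
P6adj (suc zero) zero = true
P6adj (suc zero) (suc (suc zero)) = true
P6adj (suc (suc zero)) (suc zero) = true
P6adj (suc (suc zero)) (suc (suc (suc zero))) = true
P6adj (suc (suc (suc zero))) (suc (suc zero)) = true
P6adj (suc (suc (suc zero))) (suc (suc (suc (suc zero)))) = true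
P6adj (suc (suc (suc (suc zero)))) (suc (suc (suc zero))) = true
P6adj (suc (suc (suc (suc zero)))) (suc (suc (suc (suc (suc zero))))) = true
P6adj (suc (suc (suc (suc (suc zero))))) (suc (suc (suc (suc zero)))) = true
P6adj _ _ = false

P6 : Graph 6
P6 = record { adj = P6adj ; sym = s ; irrefl = r }
  where
  s : ∀ u v → P6adj u v ≡ P6adj v u
  s zero zero = _≡_.refl
  s zero (suc zero) = _≡_.refl
  s zero (suc (suc zero)) = _≡_.refl
  s zero (suc (suc (suc zero))) = _≡_.refl
  s zero (suc (suc (suc (suc zero)))) = _≡_.refl
  s zero (suc (suc (suc (suc (suc zero))))) = _≡_.refl
  s (suc zero) zero = _≡_.refl
  s (suc zero) (suc zero) = _≡_.refl
  s (suc zero) (suc (suc zero)) = _≡_.refl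
  s (suc zero) (suc (suc (suc zero))) = _≡_.refl
  s (suc zero) (suc (suc (suc (suc zero)))) = _≡_.refl
  s (suc zero) (suc (suc (suc (suc (suc zero))))) = _≡_.refl
  s (suc (suc zero)) zero = _≡_.refl
  s (suc (suc zero)) (suc zero) = _≡_.refl
  s (suc (suc zero)) (suc (suc zero)) = _≡_.refl
  s (suc (suc zero)) (suc (suc (suc zero))) = _≡_.refl
  s (suc (suc zero)) (suc (suc (suc (suc zero)))) = _≡_.refl
  s (suc (suc zero)) (suc (suc (suc (suc (suc zero))))) = _≡_.refl
  s (suc (suc (suc zero))) zero = _≡_.refl
  s (suc (suc (suc zero))) (suc zero) = _≡_.refl
  s (suc (suc (suc zero))) (suc (suc zero)) = _≡_.refl
  s (suc (suc (suc zero))) (suc (suc (suc zero))) = _≡_.refl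
  s (suc (suc (suc zero))) (suc (suc (suc (suc zero)))) = _≡_.refl
  s (suc (suc (suc zero))) (suc (suc (suc (suc (suc zero))))) = _≡_.refl
  s (suc (suc (suc (suc zero)))) zero = _≡_.refl
  s (suc (suc (suc (suc zero)))) (suc zero) = _≡_.refl
  s (suc (suc (suc (suc zero)))) (suc (suc zero)) = _≡_.refl
  s (suc (suc (suc (suc zero)))) (suc (suc (suc zero))) = _≡_.refl
  s (suc (suc (suc (suc zero)))) (suc (suc (suc (suc zero)))) = _≡_.refl
  s (suc (suc (suc (suc zero)))) (suc (suc (suc (suc (suc zero))))) = _≡_.refl
  s (suc (suc (suc (suc (suc zero))))) zero = _≡_.refl
  s (suc (suc (suc (suc (suc zero))))) (suc zero) = _≡_.refl
  s (suc (suc (suc (suc (suc zero))))) (suc (suc zero)) = _≡_.refl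
  s (suc (suc (suc (suc (suc zero))))) (suc (suc (suc zero))) = _≡_.refl
  s (suc (suc (suc (suc (suc zero))))) (suc (suc (suc (suc zero)))) = _≡_.refl
  s (suc (suc (suc (suc (suc zero))))) (suc (suc (suc (suc (suc zero))))) = _≡_.refl
  r : ∀ v → P6adj v v ≡ false
  r zero = _≡_.refl
  r (suc zero) = _≡_.refl
  r (suc (suc zero)) = _≡_.refl
  r (suc (suc (suc zero))) = _≡_.refl
  r (suc (suc (suc (suc zero)))) = _≡_.refl
  r (suc (suc (suc (suc (suc zero))))) = _≡_.refl

Dadj : Fin 4 → Fin 4 → Bool
Dadj zero zero = false
Dadj (suc zero) (suc zero) = false
Dadj (suc (suc zero)) (suc (suc zero)) = false
Dadj (suc (suc (suc zero))) (suc (suc (suc zero))) = false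
Dadj (suc (suc zero)) (suc (suc (suc zero))) = false
Dadj (suc (suc (suc zero))) (suc (suc zero)) = false
Dadj _ _ = true

Diamond : Graph 4
Diamond = record { adj = Dadj ; sym = s ; irrefl = r }
  where
  s : ∀ u v → Dadj u v ≡ Dadj v u
  s zero zero = _≡_.refl
  s zero (suc zero) = _≡_.refl
  s zero (suc (suc zero)) = _≡_.refl
  s zero (suc (suc (suc zero))) = _≡_.refl
  s (suc zero) zero = _≡_.refl
  s (suc zero) (suc zero) = _≡_.refl
  s (suc zero) (suc (suc zero)) = _≡_.refl
  s (suc zero) (suc (suc (suc zero))) = _≡_.refl
  s (suc (suc zero)) zero = _≡_.refl
  s (suc (suc zero)) (suc zero) = _≡_.refl
  s (suc (suc zero)) (suc (suc zero)) = _≡_.refl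
  s (suc (suc zero)) (suc (suc (suc zero))) = _≡_.refl
  s (suc (suc (suc zero))) zero = _≡_.refl
  s (suc (suc (suc zero))) (suc zero) = _≡_.refl
  s (suc (suc (suc zero))) (suc (suc zero)) = _≡_.refl
  s (suc (suc (suc zero))) (suc (suc (suc zero))) = _≡_.refl
  r : ∀ v → Dadj v v ≡ false
  r zero = _≡_.refl
  r (suc zero) = _≡_.refl
  r (suc (suc zero)) = _≡_.refl
  r (suc (suc (suc zero))) = _≡_.refl

IsClique : ∀ {n k} → Graph n → (Fin k → Fin n) → Set
IsClique {n} {k} G f = ∀ i j → i ≢ j → adj G (f i) (f j) ≡ true

HasClique : ∀ {n} → Graph n → ℕ → Set
HasClique {n} G k = Σ (Fin k → Fin n) λ f → IsClique G f

-- ω(G) = w : there is a clique of size w and every clique has size ≤ w.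
-- (IsClique with i ≢ j forces injectivity since adj is irreflexive.)
CliqueNumber : ∀ {n} → Graph n → ℕ → Set
CliqueNumber G w = HasClique G w × (∀ k → HasClique G k → k ≤ w)

ProperColouring : ∀ {n} → Graph n → ℕ → Set
ProperColouring {n} G c =
  Σ (Fin n → Fin c) λ col → ∀ u v → adj G u v ≡ true → col u ≢ col v

ChromaticAtMost : ∀ {n} → Graph n → ℕ → Set
ChromaticAtMost G c = ProperColouring G c

{-# OPTIONS --safe #-}

-- In a minimal counterexample U there is no clique cutset, and N(u) ∖ N(v) has at least one element if u, v are not
-- adjacent and at least five if they are.  In a diamond-free graph a vertex outside a maximal clique T has at most one
-- neighbour in T; let A t be the set of outside neighbours of t ∈ T and Z the set of vertices without neighbour in T.
--
-- If every vertex sees every triangle, colour N(v) with ω − 1 colours and the triangle-free rest with 4 (Gyárfás).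
-- Otherwise take T of size at least 4, or, in the absence of K₄, a triangle T with Z nonempty.  A component of Z has no
-- induced P₄ starting at a neighbour in some A t, so Z is 3-colourable once it is triangle-free.  If all A t are
-- independent, T ∪ ⋃ A t needs ω colours, and Z three more.  Otherwise there is an edge x x′ inside some A a where x
-- has a neighbour y in some A b; then ⋃ A t is 3-coloured by the adjacencies to a, x and y, and T ∪ Z takes ω colours.
-- That these colourings are proper amounts to excluding a few configurations of at most nine vertices.  Each of them
-- is refuted by a finite search that repeatedly adds a vertex of some N(u) ∖ N(v) in all ways compatible with
-- P₆-, diamond- and (in the second case) K₄-freeness.
module Submission where

-- The 3-colouring of `⋃ A t` rests on a domination fact: every vertex of `A m` with `m ≢ a` sees
-- `x` or `x′`. Hence the outer vertices off `A a` split into neighbours of `x` and vertices that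
-- miss `x` but see `x′`, and an edge inside either part would form a triangle with `x` or `x′`,
-- which is excluded. One of the induced paths behind that fact ends at a fourth vertex of `T`. A
-- triangle has no such vertex, so the two cases cannot be treated alike. A vertex `p` of `Z` with a
-- neighbour in some `A t` takes its place: it is forced to see `x` or `x′`, and the remaining
-- searches start from this adjacency. This is why the triangle has to be missed by some vertex. The
-- searches are proofs by computation. A certificate lists only the pairs `u`, `v` whose private
-- neighbours are to be used; the checker enumerates the possible rows itself, `refl` runs it, and
-- its soundness is proved once for all configurations.

open import Defs hiding (sym)
open import Data.Bool as Bool using (Bool; true; false; _∧_; _∨_; not; if_then_else_)
open import Data.Bool.ListAction using (any; all)
import Data.Bool.Properties as Bool
open import Data.Empty using (⊥; ⊥-elim)
open import Data.Fin using (Fin; zero; suc; _↑ˡ_; _↑ʳ_; inject₁; inject≤; fromℕ; toℕ; splitAt; finToFun; funToFin)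
open import Data.Fin.Patterns using (0F; 1F; 2F; 3F; 4F; 5F)
open import Data.Fin.Permutation.Components using (transpose; transpose-inverse)
open import Data.Fin.Properties using (_≟_; any?; all?; ¬∀⟶∃¬; pigeonhole; ↑ˡ-injective; ↑ʳ-injective; splitAt-↑ˡ; splitAt-↑ʳ; inject≤-injective; <⇒≢; finToFun-funToFin; inject₁-injective; fromℕ≢inject₁; toℕ-inject₁)
open import Data.List as List using (List; []; _∷_; _++_; concatMap; length; filter; filterᵇ; allFin)
open import Data.List.Membership.DecPropositional using (_∈?_)
open import Data.List.Membership.Propositional using (_∈_; _∉_)
open import Data.List.Membership.Propositional.Properties using (∈-map⁺; ∈-filter⁺; ∈-filter⁻; ∈-allFin; ∈-++⁺ˡ; ∈-++⁺ʳ; ∈-lookup)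
import Data.List.Membership.Setoid.Properties as Membership
open import Data.List.Properties using (length-map; length-++)
open import Data.List.Relation.Unary.All as All using (All; []; _∷_)
open import Data.List.Relation.Unary.AllPairs using (AllPairs; []; _∷_)
open import Data.List.Relation.Unary.Any using (here; there; index)
open import Data.List.Relation.Unary.Unique.Propositional using (Unique)
open import Data.List.Relation.Unary.Unique.Propositional.Properties using (filter⁺; allFin⁺)
open import Data.Maybe using (Maybe; just; nothing)
open import Data.Nat as ℕ using (ℕ; zero; suc; _+_; _<_; _≤_; _<ᵇ_; z≤n; s≤s; s≤s⁻¹)
open import Data.Nat.Properties using (<ᵇ⇒<; ≤-trans; ≤-refl; n≤1+n; <-≤-trans; +-mono-≤; +-suc; 1+n≢n; m≤m+n; m≤n+m; n≮0)
open import Data.Product using (Σ; ∃; ∃₂; _×_; _,_; proj₁; proj₂)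
open import Data.Sum using (_⊎_; inj₁; inj₂)
open import Data.Unit using (⊤; tt)
open import Data.Vec as Vec using (Vec; []; _∷_; lookup)
open import Data.Vec.Properties using (lookup-map; lookup-zipWith)
open import Function using (_∘_; id; const)
open import Level using (0ℓ)
open import Relation.Binary.PropositionalEquality using (_≡_; _≢_; refl; sym; trans; cong; cong₂; subst; subst₂; ≢-sym; setoid)
open import Relation.Nullary using (¬_; Dec; yes; no; does)
open import Relation.Nullary.Decidable using (_×-dec_; _⊎-dec_; _→-dec_; ¬?; map′; decidable-stable; dec-true; dec-false; from-yes)
open import Relation.Unary using (Pred; Decidable)

-- Partial graphs and forbidden extensions.

-- A partially explored induced subgraph is stored as its adjacency matrix, newest vertex first; the row of a further
-- vertex records its adjacencies to the explored ones.
Row Partial : ℕ → Set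
Row k = Vec Bool k
Partial k = Vec (Maybe Bool) k

Mat : ℕ → Set
Mat k = Vec (Row k) k

pattern I = just true
pattern O = just false
pattern X = nothing

grow : ∀ {k} → Mat k → Row k → Mat (suc k)
grow M S = (false ∷ S) ∷ Vec.zipWith _∷_ S M

infix 4 _≡ᵇ_
_≡ᵇ_ : ∀ {k} → Fin k → Fin k → Bool
zero ≡ᵇ zero = true
suc i ≡ᵇ suc j = i ≡ᵇ j
_ ≡ᵇ _ = false

-- Reasons why a further vertex w is impossible: the induced paths w a b c d e, a w b c d e and a b w c d e, a diamond
-- in which w and a are the centres, a diamond in which w and c are the tips, and K₄.
data Clause (k : ℕ) : Set where
  path₁ path₂ path₃ : (a b c d e : Fin k) → Clause k
  hub tip quad : (a b c : Fin k) → Clause k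

hits : ∀ {k} → Clause k → Row k → Bool
hits (path₁ a b c d e) S = lookup S a ∧ not (lookup S b) ∧ not (lookup S c) ∧ not (lookup S d) ∧ not (lookup S e)
hits (path₂ a b c d e) S = lookup S a ∧ lookup S b ∧ not (lookup S c) ∧ not (lookup S d) ∧ not (lookup S e)
hits (path₃ a b c d e) S = lookup S b ∧ lookup S c ∧ not (lookup S a) ∧ not (lookup S d) ∧ not (lookup S e)
hits (hub a b c) S = lookup S a ∧ lookup S b ∧ lookup S c
hits (tip a b c) S = lookup S a ∧ lookup S b ∧ not (lookup S c)
hits (quad a b c) S = lookup S a ∧ lookup S b ∧ lookup S c

module _ (k₄ : Bool) {k : ℕ} (M : Mat k) where

  entry : Fin k → Fin k → Bool
  entry i j = lookup (lookup M i) j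

  -- By reversal the new vertex can be taken as the first, second or third on the path. The four
  -- links are parameters because the pair that the new vertex separates has to be non-adjacent.
  chain : (ab bc cd de : Bool → Bool) (a b c d e : Fin k) → Bool
  chain ab bc cd de a b c d e =
    ab (entry a b) ∧ bc (entry b c) ∧ cd (entry c d) ∧ de (entry d e) ∧
    not (entry a c) ∧ not (entry a d) ∧ not (entry a e) ∧
    not (entry b d) ∧ not (entry b e) ∧ not (entry c e)

  valid : Clause k → Bool
  valid (path₁ a b c d e) = chain (λ x → x) (λ x → x) (λ x → x) (λ x → x) a b c d e
  valid (path₂ a b c d e) = chain not (λ x → x) (λ x → x) (λ x → x) a b c d e
  valid (path₃ a b c d e) = chain (λ x → x) not (λ x → x) (λ x → x) a b c d e
  -- The tips of a diamond are twins, so adjacency does not tell them apart and their distinctness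
  -- is tested; in `tip` it follows because one tip is new.
  valid (hub a b c) = entry a b ∧ entry a c ∧ not (entry b c) ∧ not (b ≡ᵇ c)
  valid (tip a b c) = entry a b ∧ entry a c ∧ entry b c
  valid (quad a b c) = k₄ ∧ entry a b ∧ entry a c ∧ entry b c

nbrs : ∀ {k} → Mat k → Vec (List (Fin k)) k
nbrs M = Vec.map (λ r → filterᵇ (lookup r) (allFin _)) M

-- The enumeration is restricted to clauses involving the newest vertex and needs no correctness proof, because its
-- results are filtered by valid.
module _ {k : ℕ} (M : Mat (suc k)) (nbr : Vec (List (Fin (suc k))) (suc k)) (ids : List (Fin (suc k))) where
  private
    N : Fin (suc k) → List (Fin (suc k))
    N = lookup nbr

    adjacent far : Fin (suc k) → Fin (suc k) → Bool
    adjacent i j = lookup (lookup M i) j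
    far i j = not (adjacent i j ∨ (i ≡ᵇ j))

    old : Fin (suc k) → Bool
    old zero = false
    old (suc _) = true

    when : ∀ {A : Set} → Bool → List A → List A
    when true xs = xs
    when false _ = []

    -- If all vertices chosen so far are old, only the newest one can complete a clause not
    -- generated before. It may be missing from the list that it replaces, hence the adjacency tests
    -- that follow each use.
    pool : Bool → List (Fin (suc k)) → List (Fin (suc k))
    pool true _ = zero ∷ []
    pool false is = is

    fromP₄ : (a b c d : Fin (suc k)) → Bool → List (Clause (suc k))
    fromP₄ a b c d o =
      concatMap (λ e → when (adjacent a e ∧ far b e ∧ far c e ∧ far d e) (path₁ e a b c d ∷ [])) (pool o (N a)) ++
      concatMap (λ e → when (far a e ∧ far b e ∧ far c e ∧ far d e) (path₂ e a b c d ∷ [])) (pool o ids)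

    fromP₃ : (a b c : Fin (suc k)) → Bool → List (Clause (suc k))
    fromP₃ a b c o =
      concatMap (λ d → when (far b d ∧ far c d) (fromP₄ d a b c (o ∧ old d))) (N a) ++
      concatMap (λ d → when (far a d ∧ far b d ∧ far c d)
        (concatMap (λ e → when (adjacent d e ∧ far a e ∧ far b e ∧ far c e) (path₃ e d a b c ∷ []))
          (pool (o ∧ old d) (N d)))) ids ++
      when (not o) (hub b a c ∷ [])

    triangles : List (Clause (suc k))
    triangles = concatMap (λ a → concatMap (λ b → concatMap (λ c →
      when (adjacent a c ∧ adjacent b c) (tip a b c ∷ quad a b c ∷ [])) (pool (old a ∧ old b) (N b))) (N a)) ids

  candidates : List (Clause (suc k))
  candidates = triangles ++ concatMap (λ b → concatMap (λ a → concatMap (λ c →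
    when (far a c) (fromP₃ a b c (old a ∧ old b ∧ old c))) (N b)) (N b)) ids

clauses : Bool → ∀ {k} → Mat (suc k) → List (Clause (suc k))
clauses k₄ M = filterᵇ (valid k₄ M) (candidates M (nbrs M) (allFin _))

prune : ∀ {k} → List (Clause k) → List (Row k) → List (Row k)
prune cl [] = []
prune cl (S ∷ Ss) = if any (λ c → hits c S) cl then prune cl Ss else S ∷ prune cl Ss

-- A further vertex may or may not see the newest one. The rows being doubled have survived all
-- earlier clauses, so only clauses on the newest vertex remain to be applied.
double : ∀ {k} → List (Row k) → List (Row (suc k))
double [] = []
double (S ∷ Ss) = (false ∷ S) ∷ (true ∷ S) ∷ double Ss

-- Certificates and their checker.

-- need u v ts: some unexplored vertex is adjacent to u but not to v; ts treats its possible rows one by one.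
-- split ts: likewise for the next vertex of a prescribed configuration.
data Cert : Set where
  need : ℕ → ℕ → List Cert → Cert
  split : List Cert → Cert

fin? : ∀ k → ℕ → Maybe (Fin k)
fin? zero _ = nothing
fin? (suc k) zero = just zero
fin? (suc k) (suc i) with fin? k i
... | just j = just (suc j)
... | nothing = nothing

sel : ∀ {k} → Fin k → Fin k → Row k → Bool
sel u v S = lookup S u ∧ not (lookup S v)

-- In a minimal counterexample N(u) ∖ N(v) is nonempty if u and v are not adjacent, and has at least five elements
-- (one of them v) if they are, since N(u) ∩ N(v) has at most ω − 2 elements and u has degree at least ω + 3.
quota : Bool → ℕ
quota true = 5
quota false = 1

deficient : ∀ {k} → Mat k → Fin k → Fin k → Bool
deficient M u v = not (u ≡ᵇ v) ∧
  (length (filterᵇ (λ i → sel u v (lookup M i)) (allFin _)) <ᵇ quota (lookup (lookup M u) v))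

data Specs : ℕ → Set where
  [] : ∀ {k} → Specs k
  _∷_ : ∀ {k} → Partial k → Specs (suc k) → Specs k

fits : ∀ {k} → Partial k → Row k → Bool
fits [] [] = true
fits (nothing ∷ s) (x ∷ S) = fits s S
fits (just true ∷ s) (x ∷ S) = x ∧ fits s S
fits (just false ∷ s) (x ∷ S) = not x ∧ fits s S

module _ (k₄ : Bool) where

  solve : ∀ {k} → Mat k → List (Clause k) → List (Row k) → Cert → Bool
  branch : ∀ {k} → Mat k → (todo rest : List (Row k)) → List Cert → Bool
  attempt : ∀ {k} → Mat k → List (Clause k) → List (Row k) → Maybe (Fin k) → Maybe (Fin k) → List Cert → Bool

  solve {k} M cl Ss (need u v ts) = attempt M cl Ss (fin? k u) (fin? k v) ts
  solve M cl Ss (split _) = false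

  attempt M cl Ss (just u) (just v) ts = deficient M u v ∧
    branch M (prune cl (filterᵇ (sel u v) Ss)) (prune cl (filterᵇ (λ S → not (sel u v S)) Ss)) ts
  attempt M cl Ss _ _ ts = false

  -- A row that has been refuted is dropped from the candidates for all later vertices.
  branch M [] rest ts = true
  branch M (S ∷ todo) rest [] = false
  branch M (S ∷ todo) rest (t ∷ ts) =
    solve (grow M S) (clauses k₄ (grow M S)) (double (S ∷ todo ++ rest)) t ∧ branch M todo rest ts

  refute : ∀ {k} → Specs k → Mat k → List (Clause k) → List (Row k) → Cert → Bool
  each : ∀ {k} → Specs (suc k) → Mat k → (Ss todo : List (Row k)) → List Cert → Bool
  refute [] M cl Ss t = solve M cl Ss t
  -- No explored vertex fits `s`, so a vertex that does is new: distinctness within a configuration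
  -- is checked here rather than assumed.
  refute (s ∷ ss) M cl Ss (split ts) = all (λ i → not (fits s (lookup M i))) (allFin _) ∧
    each ss M (prune cl Ss) (prune cl (filterᵇ (fits s) Ss)) ts
  refute (s ∷ ss) M cl Ss (need _ _ _) = false

  each ss M Ss [] ts = true
  each ss M Ss (S ∷ todo) [] = false
  -- In contrast to `branch`, a refuted row stays in `Ss`: its refutation presupposes a vertex that
  -- continues the prescribed configuration.
  each ss M Ss (S ∷ todo) (t ∷ ts) =
    refute ss (grow M S) (clauses k₄ (grow M S)) (double Ss) t ∧ each ss M Ss todo ts

data Refuted (k₄ : Bool) (ss : Specs 0) : Set where
  certified : ∀ t → refute k₄ ss [] [] ([] ∷ []) t ≡ true → Refuted k₄ ss

-- Soundness of the checker.

∧-true : ∀ {a b} → a ∧ b ≡ true → a ≡ true × b ≡ true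
∧-true {true} {true} refl = refl , refl

not-true : ∀ {a} → not a ≡ true → a ≡ false
not-true {false} refl = refl

∈-filterᵇ⁺ : ∀ {A : Set} (f : A → Bool) {x xs} → x ∈ xs → f x ≡ true → x ∈ filterᵇ f xs
∈-filterᵇ⁺ f {xs = y ∷ xs} (here refl) fx rewrite fx = here refl
∈-filterᵇ⁺ f {xs = y ∷ xs} (there x∈) fx with f y
... | true = there (∈-filterᵇ⁺ f x∈ fx)
... | false = ∈-filterᵇ⁺ f x∈ fx

∈-filterᵇ⁻ : ∀ {A : Set} (f : A → Bool) {x} xs → x ∈ filterᵇ f xs → f x ≡ true
∈-filterᵇ⁻ f (y ∷ xs) x∈ with f y in fy
∈-filterᵇ⁻ f (y ∷ xs) (here refl) | true = fy
∈-filterᵇ⁻ f (y ∷ xs) (there x∈) | true = ∈-filterᵇ⁻ f xs x∈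
∈-filterᵇ⁻ f (y ∷ xs) x∈ | false = ∈-filterᵇ⁻ f xs x∈

any-true : ∀ {A : Set} (f : A → Bool) xs → any f xs ≡ true → ∃ λ x → x ∈ xs × f x ≡ true
any-true f (x ∷ xs) h with f x in fx
... | true = x , here refl , fx
... | false with any-true f xs h
... | y , y∈ , fy = y , there y∈ , fy

all-true : ∀ {A : Set} (f : A → Bool) {xs x} → all f xs ≡ true → x ∈ xs → f x ≡ true
all-true f {y ∷ xs} h (here refl) = proj₁ (∧-true h)
all-true f {y ∷ xs} h (there x∈) = all-true f (proj₂ (∧-true {f y} h)) x∈

prune-keeps : ∀ {k} (cl : List (Clause k)) {S Ss} → S ∈ Ss → (∀ c → c ∈ cl → hits c S ≢ true) → S ∈ prune cl Ss
prune-keeps cl {S} {Ss = S ∷ Ss} (here refl) live with any (λ c → hits c S) cl in h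
... | false = here refl
... | true with any-true (λ c → hits c S) cl h
... | c , c∈ , hc = ⊥-elim (live c c∈ hc)
prune-keeps cl {S} {S′ ∷ Ss} (there S∈) live with any (λ c → hits c S′) cl
... | true = prune-keeps cl S∈ live
... | false = there (prune-keeps cl S∈ live)

∈-double : ∀ {k} b {S : Row k} {Ss} → S ∈ Ss → (b ∷ S) ∈ double Ss
∈-double false (here refl) = here refl
∈-double true (here refl) = there (here refl)
∈-double b (there S∈) = there (there (∈-double b S∈))

≡ᵇ-refl : ∀ {k} (i : Fin k) → (i ≡ᵇ i) ≡ true
≡ᵇ-refl zero = refl
≡ᵇ-refl (suc i) = ≡ᵇ-refl i

Match : ∀ {k} → Partial k → Row k → Set
Match [] [] = ⊤
Match (just b ∷ s) (x ∷ S) = x ≡ b × Match s S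
Match (nothing ∷ s) (x ∷ S) = Match s S

fits-complete : ∀ {k} (s : Partial k) (S : Row k) → Match s S → fits s S ≡ true
fits-complete [] [] _ = refl
fits-complete (just true ∷ s) (x ∷ S) (refl , m) = fits-complete s S m
fits-complete (just false ∷ s) (x ∷ S) (refl , m) = fits-complete s S m
fits-complete (nothing ∷ s) (x ∷ S) m = fits-complete s S m

module Soundness
  {V : Set} (adj : V → V → Bool) (adj-sym : ∀ u v → adj u v ≡ adj v u) (adj-irr : ∀ v → adj v v ≡ false)
  (U : V → Set)
  (no-P₆ : ∀ a b c d e f →
     adj a b ≡ true → adj b c ≡ true → adj c d ≡ true → adj d e ≡ true → adj e f ≡ true →
     adj a c ≡ false → adj a d ≡ false → adj a e ≡ false → adj a f ≡ false → adj b d ≡ false →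
     adj b e ≡ false → adj b f ≡ false → adj c e ≡ false → adj c f ≡ false → adj d f ≡ false → ⊥)
  (no-diamond : ∀ a b x y → adj a b ≡ true → adj a x ≡ true → adj b x ≡ true → adj a y ≡ true → adj b y ≡ true →
     x ≢ y → adj x y ≡ false → ⊥)
  (k₄ : Bool)
  (no-K₄ : k₄ ≡ true → ∀ a b c d → U a → U b → U c → U d → adj a b ≡ true → adj a c ≡ true → adj a d ≡ true →
     adj b c ≡ true → adj b d ≡ true → adj c d ≡ true → ⊥)
  (private-nbr : ∀ u v → U u → U v → u ≢ v → ∀ L → length L < quota (adj u v) →
     ∃ λ w → U w × adj w u ≡ true × adj w v ≡ false × w ∉ L)
  where

  record Real {k} (M : Mat k) (ρ : Vec V k) : Set where
    field
      faithful : ∀ i j → lookup (lookup M i) j ≡ adj (lookup ρ i) (lookup ρ j)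
      distinct : ∀ i j → lookup ρ i ≡ lookup ρ j → i ≡ j
      inside : ∀ i → U (lookup ρ i)
  open Real

  New : ∀ {k} → V → Vec V k → Set
  New w ρ = ∀ i → lookup ρ i ≢ w

  row : ∀ {k} → V → Vec V k → Row k
  row w ρ = Vec.map (adj w) ρ

  -- The invariant of the search: a row may leave the list only if no unexplored vertex of `U` has
  -- it.
  Covers : ∀ {k} → Vec V k → List (Row k) → Set
  Covers ρ Ss = ∀ w → U w → New w ρ → row w ρ ∈ Ss

  Realised : ∀ {k} → Specs k → Vec V k → Set
  Realised [] ρ = ⊤
  Realised (s ∷ ss) ρ = Σ V λ v → U v × Match s (row v ρ) × Realised ss (v ∷ ρ)

  real-grow : ∀ {k} {M : Mat k} {ρ w} → Real M ρ → U w → New w ρ → Real (grow M (row w ρ)) (w ∷ ρ)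
  real-grow {M = M} {ρ} {w} R Uw new = record { faithful = f ; distinct = d ; inside = i }
    where
    f : ∀ i j → lookup (lookup (grow M (row w ρ)) i) j ≡ adj (lookup (w ∷ ρ) i) (lookup (w ∷ ρ) j)
    f zero zero = sym (adj-irr w)
    f zero (suc j) = lookup-map j (adj w) ρ
    f (suc i) zero = trans (cong (λ r → lookup r zero) (lookup-zipWith _∷_ i (row w ρ) M))
      (trans (lookup-map i (adj w) ρ) (adj-sym _ _))
    f (suc i) (suc j) = trans (cong (λ r → lookup r (suc j)) (lookup-zipWith _∷_ i (row w ρ) M)) (faithful R i j)
    d : ∀ i j → lookup (w ∷ ρ) i ≡ lookup (w ∷ ρ) j → i ≡ j
    d zero zero _ = refl
    d zero (suc j) eq = ⊥-elim (new j (sym eq))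
    d (suc i) zero eq = ⊥-elim (new i eq)
    d (suc i) (suc j) eq = cong suc (distinct R i j eq)
    i : ∀ i → U (lookup (w ∷ ρ) i)
    i zero = Uw
    i (suc j) = inside R j

  module _ {k} {M : Mat k} {ρ : Vec V k} (R : Real M ρ) {w : V} (Uw : U w) (new : New w ρ) where

    private
      at : Fin k → V
      at = lookup ρ

      m⁺ : ∀ {i j b} → lookup (lookup M i) j ≡ b → adj (at i) (at j) ≡ b
      m⁺ {i} {j} eq = trans (sym (faithful R i j)) eq

      s⁺ : ∀ {i b} → lookup (row w ρ) i ≡ b → adj w (at i) ≡ b
      s⁺ {i} eq = trans (sym (lookup-map i (adj w) ρ)) eq

      flip : ∀ {u v b} → adj u v ≡ b → adj v u ≡ b
      flip {u} {v} eq = trans (adj-sym v u) eq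

    clause-sound : ∀ c → valid k₄ M c ≡ true → hits c (row w ρ) ≡ true → ⊥
    clause-sound (path₁ a b c d e) va h
      with ab , va ← ∧-true va with bc , va ← ∧-true va with cd , va ← ∧-true va with de , va ← ∧-true va
      with ac , va ← ∧-true va with ad , va ← ∧-true va with ae , va ← ∧-true va with bd , va ← ∧-true va
      with be , ce ← ∧-true va
      with sa , h ← ∧-true h with sb , h ← ∧-true h with sc , h ← ∧-true h with sd , se ← ∧-true h
      = no-P₆ w (at a) (at b) (at c) (at d) (at e)
          (s⁺ sa) (m⁺ ab) (m⁺ bc) (m⁺ cd) (m⁺ de)
          (s⁺ (not-true sb)) (s⁺ (not-true sc)) (s⁺ (not-true sd)) (s⁺ (not-true se))
          (m⁺ (not-true ac)) (m⁺ (not-true ad)) (m⁺ (not-true ae)) (m⁺ (not-true bd)) (m⁺ (not-true be)) (m⁺ (not-true ce))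
    clause-sound (path₂ a b c d e) va h
      with ab , va ← ∧-true va with bc , va ← ∧-true va with cd , va ← ∧-true va with de , va ← ∧-true va
      with ac , va ← ∧-true va with ad , va ← ∧-true va with ae , va ← ∧-true va with bd , va ← ∧-true va
      with be , ce ← ∧-true va
      with sa , h ← ∧-true h with sb , h ← ∧-true h with sc , h ← ∧-true h with sd , se ← ∧-true h
      = no-P₆ (at a) w (at b) (at c) (at d) (at e)
          (flip (s⁺ sa)) (s⁺ sb) (m⁺ bc) (m⁺ cd) (m⁺ de)
          (m⁺ (not-true ab)) (m⁺ (not-true ac)) (m⁺ (not-true ad)) (m⁺ (not-true ae))
          (s⁺ (not-true sc)) (s⁺ (not-true sd)) (s⁺ (not-true se)) (m⁺ (not-true bd)) (m⁺ (not-true be)) (m⁺ (not-true ce))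
    clause-sound (path₃ a b c d e) va h
      with ab , va ← ∧-true va with bc , va ← ∧-true va with cd , va ← ∧-true va with de , va ← ∧-true va
      with ac , va ← ∧-true va with ad , va ← ∧-true va with ae , va ← ∧-true va with bd , va ← ∧-true va
      with be , ce ← ∧-true va
      with sb , h ← ∧-true h with sc , h ← ∧-true h with sa , h ← ∧-true h with sd , se ← ∧-true h
      = no-P₆ (at a) (at b) w (at c) (at d) (at e)
          (m⁺ ab) (flip (s⁺ sb)) (s⁺ sc) (m⁺ cd) (m⁺ de)
          (flip (s⁺ (not-true sa))) (m⁺ (not-true ac)) (m⁺ (not-true ad)) (m⁺ (not-true ae))
          (m⁺ (not-true bc)) (m⁺ (not-true bd)) (m⁺ (not-true be)) (s⁺ (not-true sd)) (s⁺ (not-true se)) (m⁺ (not-true ce))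
    clause-sound (hub a b c) va h
      with ab , va ← ∧-true va with ac , va ← ∧-true va with bc , b≢c ← ∧-true va
      with sa , h ← ∧-true h with sb , sc ← ∧-true h
      = no-diamond w (at a) (at b) (at c) (s⁺ sa) (s⁺ sb) (m⁺ ab) (s⁺ sc) (m⁺ ac) b≠c (m⁺ (not-true bc))
      where
      b≠c : at b ≢ at c
      b≠c eq with refl ← distinct R b c eq with () ← trans (sym (cong not (≡ᵇ-refl b))) b≢c
    clause-sound (tip a b c) va h
      with ab , va ← ∧-true va with ac , bc ← ∧-true va
      with sa , h ← ∧-true h with sb , sc ← ∧-true h
      = no-diamond (at a) (at b) (at c) w (m⁺ ab) (m⁺ ac) (m⁺ bc) (flip (s⁺ sa)) (flip (s⁺ sb)) (new c) (flip (s⁺ (not-true sc)))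
    clause-sound (quad a b c) va h
      with kk , va ← ∧-true va with ab , va ← ∧-true va with ac , bc ← ∧-true va
      with sa , h ← ∧-true h with sb , sc ← ∧-true h
      = no-K₄ kk w (at a) (at b) (at c) Uw (inside R a) (inside R b) (inside R c) (s⁺ sa) (s⁺ sb) (s⁺ sc) (m⁺ ab) (m⁺ ac) (m⁺ bc)

  Valid : ∀ {k} → Mat k → List (Clause k) → Set
  Valid M cl = ∀ c → c ∈ cl → valid k₄ M c ≡ true

  clauses-valid : ∀ {k} (M : Mat (suc k)) → Valid M (clauses k₄ M)
  clauses-valid M c = ∈-filterᵇ⁻ (valid k₄ M) (candidates M (nbrs M) (allFin _))

  kept : ∀ {k} {M : Mat k} {ρ cl} → Real M ρ → Valid M cl → ∀ {w Ss} → U w → New w ρ → row w ρ ∈ Ss → row w ρ ∈ prune cl Ss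
  kept R val Uw new w∈ = prune-keeps _ w∈ λ c c∈ → clause-sound R Uw new c (val c c∈)

  covers-double : ∀ {k} {ρ : Vec V k} {v Ss} → Covers ρ Ss → Covers (v ∷ ρ) (double Ss)
  covers-double cov w Uw new = ∈-double _ (cov w Uw (new ∘ suc))

  solve-sound : ∀ {k} {M : Mat k} {ρ cl Ss} t → Real M ρ → Valid M cl → Covers ρ Ss → solve k₄ M cl Ss t ≢ true
  branch-sound : ∀ {k} {M : Mat k} {ρ} todo rest ts → Real M ρ → Covers ρ (todo ++ rest) → branch k₄ M todo rest ts ≡ true →
    ∀ w → U w → New w ρ → row w ρ ∈ todo → ⊥
  attempt-sound : ∀ {k} {M : Mat k} {ρ cl Ss} u v ts → Real M ρ → Valid M cl → Covers ρ Ss → attempt k₄ M cl Ss u v ts ≢ true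

  solve-sound {k} (need u v ts) = attempt-sound (fin? k u) (fin? k v) ts
  solve-sound (split _) _ _ _ ()

  branch-sound {ρ = ρ} (S ∷ todo) rest (t ∷ ts) R cov ok w Uw new w∈ = go w∈
    where
    excluded : ∀ w → U w → New w ρ → row w ρ ≢ S
    excluded w Uw new refl = solve-sound t (real-grow R Uw new) (clauses-valid _) (covers-double cov) (proj₁ (∧-true ok))
    -- `excluded` holds for every unexplored vertex and not just for the one supplied by `need`, so
    -- the invariant survives the removal of `S`.
    cov′ : Covers ρ (todo ++ rest)
    cov′ w Uw new with cov w Uw new
    ... | here eq = ⊥-elim (excluded w Uw new eq)
    ... | there w∈ = w∈
    go : row w ρ ∈ S ∷ todo → ⊥
    go (here eq) = excluded w Uw new eq
    go (there w∈) = branch-sound todo rest ts R cov′ (proj₂ (∧-true ok)) w Uw new w∈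

  attempt-sound {M = M} {ρ} {cl} {Ss} (just u) (just v) ts R val cov ok
    with def , br ← ∧-true ok with u≢v , few ← ∧-true def
    = branch-sound todo rest ts R cov′ br w Uw new (kept R val Uw new (∈-filterᵇ⁺ (sel u v) (cov w Uw new) selw))
    where
    todo = prune cl (filterᵇ (sel u v) Ss)
    rest = prune cl (filterᵇ (λ S → not (sel u v S)) Ss)
    known = filterᵇ (λ i → sel u v (lookup M i)) (allFin _)
    u≠v : lookup ρ u ≢ lookup ρ v
    u≠v eq with refl ← distinct R u v eq with () ← trans (sym (cong not (≡ᵇ-refl u))) u≢v
    bound : length (List.map (lookup ρ) known) < quota (adj (lookup ρ u) (lookup ρ v))
    bound rewrite length-map (lookup ρ) known | sym (faithful R u v) = <ᵇ⇒< _ _ (subst Bool.T (sym few) tt)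
    found = private-nbr (lookup ρ u) (lookup ρ v) (inside R u) (inside R v) u≠v (List.map (lookup ρ) known) bound
    w = proj₁ found
    Uw = proj₁ (proj₂ found)
    wu = proj₁ (proj₂ (proj₂ found))
    wv = proj₁ (proj₂ (proj₂ (proj₂ found)))
    new : New w ρ
    new i eq = proj₂ (proj₂ (proj₂ (proj₂ found))) (subst (_∈ _) eq (∈-map⁺ (lookup ρ) (∈-filterᵇ⁺ _ (∈-allFin i) seli)))
      where
      seli : sel u v (lookup M i) ≡ true
      seli rewrite faithful R i u | faithful R i v | eq | wu | wv = refl
    selw : sel u v (row w ρ) ≡ true
    selw rewrite lookup-map u (adj w) ρ | lookup-map v (adj w) ρ | wu | wv = refl
    cov′ : Covers ρ (todo ++ rest)
    cov′ x Ux newx with sel u v (row x ρ) in eq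
    ... | true = ∈-++⁺ˡ (kept R val Ux newx (∈-filterᵇ⁺ (sel u v) (cov x Ux newx) eq))
    ... | false = ∈-++⁺ʳ todo (kept R val Ux newx (∈-filterᵇ⁺ _ (cov x Ux newx) (cong not eq)))

  refute-sound : ∀ {k} {M : Mat k} {ρ cl Ss} ss t → Real M ρ → Valid M cl → Covers ρ Ss →
    refute k₄ ss M cl Ss t ≡ true → Realised ss ρ → ⊥
  each-sound : ∀ {k} {M : Mat k} {ρ Ss} ss todo ts → Real M ρ → Covers ρ Ss → each k₄ ss M Ss todo ts ≡ true →
    ∀ w → U w → New w ρ → row w ρ ∈ todo → Realised ss (w ∷ ρ) → ⊥

  refute-sound [] t R val cov ok _ = solve-sound t R val cov ok
  refute-sound {M = M} {ρ} {cl} {Ss} (s ∷ ss) (split ts) R val cov ok (w , Uw , m , more)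
    with apart , ok′ ← ∧-true ok
    = each-sound ss (prune cl (filterᵇ (fits s) Ss)) ts R (λ x Ux newx → kept R val Ux newx (cov x Ux newx)) ok′ w Uw new
        (kept R val Uw new (∈-filterᵇ⁺ (fits s) (cov w Uw new) (fits-complete s _ m))) more
    where
    old-row : ∀ i → lookup M i ≡ row (lookup ρ i) ρ
    old-row i = Vec-ext λ j → trans (faithful R i j) (sym (lookup-map j (adj (lookup ρ i)) ρ))
      where
      Vec-ext : ∀ {n} {xs ys : Vec Bool n} → (∀ j → lookup xs j ≡ lookup ys j) → xs ≡ ys
      Vec-ext {xs = []} {[]} _ = refl
      Vec-ext {xs = x ∷ xs} {y ∷ ys} h = cong₂ _∷_ (h zero) (Vec-ext (h ∘ suc))
    new : New w ρ
    new i refl with () ← trans (sym (all-true _ apart (∈-allFin i))) (cong not (trans (cong (fits s) (old-row i)) (fits-complete s _ m)))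

  each-sound ss (S ∷ todo) (t ∷ ts) R cov ok w Uw new (here refl) more =
    refute-sound ss t (real-grow R Uw new) (clauses-valid _) (covers-double cov) (proj₁ (∧-true ok)) more
  each-sound ss (S ∷ todo) (t ∷ ts) R cov ok w Uw new (there w∈) more =
    each-sound ss todo ts R cov (proj₂ (∧-true ok)) w Uw new w∈ more

  refuted : ∀ {ss} → Refuted k₄ ss → ¬ Realised ss []
  refuted {ss} (certified t ok) =
    refute-sound ss t (record { faithful = λ () ; distinct = λ () ; inside = λ () }) (λ _ ()) (λ _ _ _ → here refl) ok

-- Certified configurations.

-- Rows list the newest vertex first.  K₄-config extends four vertices a, b, m, n′ of a clique by x, x′ attached to a
-- and y attached to b, where x is adjacent to x′ and y; K₃-config does the same for a triangle a, b, m.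
K₄-clique : Specs 4 → Specs 0
K₄-clique ss = [] ∷ (I ∷ []) ∷ (I ∷ I ∷ []) ∷ (I ∷ I ∷ I ∷ []) ∷ ss

K₄-config : Specs 7 → Specs 0
K₄-config ss = K₄-clique ((O ∷ O ∷ O ∷ I ∷ []) ∷ (I ∷ O ∷ O ∷ O ∷ I ∷ []) ∷ (O ∷ I ∷ O ∷ O ∷ I ∷ O ∷ []) ∷ ss)

K₃-clique : Specs 3 → Specs 0
K₃-clique ss = [] ∷ (I ∷ []) ∷ (I ∷ I ∷ []) ∷ ss

K₃-config : Specs 6 → Specs 0
K₃-config ss = K₃-clique ((O ∷ O ∷ I ∷ []) ∷ (I ∷ O ∷ O ∷ I ∷ []) ∷ (O ∷ I ∷ O ∷ I ∷ O ∷ []) ∷ ss)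

-- Let `v` be the last vertex. If `v` misses `y`, then `x′ x y b m v` is an induced path, and
-- otherwise `x′ x y v m n′` is; the second path uses the fourth clique vertex. In these names `-a`,
-- `-b` or `-m` is the clique vertex to which the additional vertex is attached.
K₄-undominated-m : Refuted false (K₄-config ((X ∷ O ∷ O ∷ O ∷ I ∷ O ∷ O ∷ []) ∷ []))
K₄-undominated-m = certified
  (split (split (split (split (split (split (split (split [] ∷ []) ∷ []) ∷ []) ∷ []) ∷ []) ∷ []) ∷ []))
  refl

K₄-undominated-b : Refuted false (K₄-config ((X ∷ O ∷ O ∷ O ∷ O ∷ I ∷ O ∷ []) ∷ []))
K₄-undominated-b = certified
  (split (split (split (split (split (split (split (split (need 4 5 [] ∷ need 4 5 [] ∷ []) ∷ []) ∷ []) ∷ []) ∷ []) ∷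
  []) ∷ []) ∷ []))
  refl

K₄-triangle : Refuted false (K₄-config ((I ∷ O ∷ I ∷ O ∷ I ∷ O ∷ O ∷ []) ∷ []))
K₄-triangle = certified
  (split (split (split (split (split (split (split (split (need 2 3 [] ∷ []) ∷ []) ∷ []) ∷ []) ∷ []) ∷ []) ∷ []) ∷
  []))
  refl

K₄-third : Refuted false (K₄-config ((O ∷ I ∷ I ∷ O ∷ O ∷ O ∷ I ∷ []) ∷ []))
K₄-third = certified
  (split (split (split (split (split (split (split (split (need 0 2 (need 5 6 [] ∷ need 1 3 [] ∷ []) ∷ []) ∷ []) ∷
  []) ∷ []) ∷ []) ∷ []) ∷ []) ∷ []))
  refl

K₄-crossing-b : Refuted false (K₄-config ((O ∷ O ∷ O ∷ O ∷ O ∷ O ∷ I ∷ []) ∷ (I ∷ X ∷ X ∷ I ∷ O ∷ O ∷ I ∷ O ∷ []) ∷ []))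
K₄-crossing-b = certified
  (split (split (split (split (split (split (split (split (split (need 5 6 (need 6 7 [] ∷ need 4 5 [] ∷ need 1 9 []
  ∷ []) ∷ []) ∷ []) ∷ []) ∷ []) ∷ []) ∷ []) ∷ []) ∷ []) ∷ []))
  refl

K₄-crossing-m : Refuted false (K₄-config ((O ∷ O ∷ O ∷ O ∷ O ∷ O ∷ I ∷ []) ∷ (I ∷ X ∷ X ∷ I ∷ O ∷ I ∷ O ∷ O ∷ []) ∷ []))
K₄-crossing-m = certified
  (split (split (split (split (split (split (split (split (split (need 3 4 [] ∷ []) ∷ []) ∷ []) ∷ []) ∷ []) ∷ []) ∷
  []) ∷ []) ∷ []))
  refl

K₄-edge : Refuted false (K₄-config ((O ∷ O ∷ O ∷ O ∷ O ∷ O ∷ I ∷ []) ∷ (I ∷ O ∷ O ∷ O ∷ O ∷ O ∷ O ∷ I ∷ []) ∷ []))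
K₄-edge = certified
  (split (split (split (split (split (split (split (split (split (need 0 1 (need 3 9 (need 3 2 [] ∷ []) ∷ need 2 1
  [] ∷ need 3 9 [] ∷ []) ∷ []) ∷ []) ∷ []) ∷ []) ∷ []) ∷ []) ∷ []) ∷ []) ∷ []))
  refl

K₄-tail : Refuted false (K₄-clique ((O ∷ O ∷ O ∷ O ∷ []) ∷ (I ∷ O ∷ O ∷ O ∷ O ∷ []) ∷ (I ∷ I ∷ O ∷ O ∷ O ∷ O ∷ []) ∷ (O ∷ O ∷ I ∷ O ∷ O ∷ O ∷ I ∷ []) ∷ []))
K₄-tail = certified
  (split (split (split (split (split (split (split (split (need 1 2 (need 0 8 (need 6 7 [] ∷ []) ∷ need 5 6 [] ∷
  need 1 4 [] ∷ []) ∷ []) ∷ []) ∷ []) ∷ []) ∷ []) ∷ []) ∷ []) ∷ []))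
  refl

K₃-tail : Refuted true (K₃-clique ((O ∷ O ∷ O ∷ []) ∷ (I ∷ O ∷ O ∷ O ∷ []) ∷ (I ∷ I ∷ O ∷ O ∷ O ∷ []) ∷ (O ∷ O ∷ I ∷ O ∷ O ∷ I ∷ []) ∷ []))
K₃-tail = certified
  (split (split (split (split (split (split (split (need 1 2 (need 5 6 [] ∷ need 2 0 [] ∷ []) ∷ []) ∷ []) ∷ []) ∷
  []) ∷ []) ∷ []) ∷ []))
  refl

-- The `K₃-unlinked` searches force a vertex `p` of `Z` to see `x` or `x′`. What ties `p` to the
-- triangle is a neighbour `q` in `A a`, `A b` or `A m`, or, in the last of them, `y` itself.
K₃-unlinked-a : Refuted true (K₃-config ((O ∷ O ∷ O ∷ O ∷ O ∷ O ∷ []) ∷ (I ∷ X ∷ X ∷ X ∷ O ∷ O ∷ I ∷ []) ∷ []))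
K₃-unlinked-a = certified
  (split (split (split (split (split (split (split (split (need 1 0 (need 2 0 (need 0 1 (need 10 6 (need 0 4 [] ∷
  []) ∷ []) ∷ need 3 1 (need 0 1 [] ∷ need 0 3 (need 0 1 (need 5 2 (need 7 3 [] ∷ []) ∷ []) ∷ []) ∷ []) ∷ need 0 2
  (need 0 1 (need 4 2 (need 6 4 [] ∷ []) ∷ []) ∷ []) ∷ need 3 1 [] ∷ []) ∷ need 3 5 (need 3 0 [] ∷ need 4 6 [] ∷
  need 4 1 [] ∷ []) ∷ need 2 1 (need 3 2 (need 4 3 (need 5 11 (need 1 2 (need 3 2 (need 0 2 [] ∷ []) ∷ []) ∷ need 1
  2 (need 8 1 [] ∷ []) ∷ []) ∷ []) ∷ []) ∷ []) ∷ []) ∷ need 1 0 (need 2 0 (need 0 1 (need 10 6 (need 0 4 [] ∷ []) ∷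
  []) ∷ need 3 1 (need 0 1 [] ∷ need 0 3 (need 4 1 (need 6 2 [] ∷ []) ∷ []) ∷ []) ∷ need 0 2 (need 4 5 [] ∷ []) ∷
  []) ∷ need 2 0 (need 0 1 [] ∷ need 3 0 (need 0 1 [] ∷ need 0 3 [] ∷ []) ∷ need 0 2 [] ∷ need 3 1 [] ∷ []) ∷ need 2
  0 (need 0 1 [] ∷ need 0 2 [] ∷ need 3 1 [] ∷ []) ∷ need 2 0 (need 0 1 (need 6 7 [] ∷ []) ∷ need 2 0 (need 6 7 [] ∷
  need 1 3 (need 5 3 [] ∷ []) ∷ []) ∷ need 3 1 [] ∷ []) ∷ need 2 1 (need 3 2 (need 4 5 (need 1 2 [] ∷ need 1 2 [] ∷
  need 1 2 (need 3 2 [] ∷ []) ∷ []) ∷ []) ∷ []) ∷ []) ∷ []) ∷ []) ∷ []) ∷ []) ∷ []) ∷ []) ∷ []) ∷ []))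
  refl

K₃-unlinked-b : Refuted true (K₃-config ((O ∷ O ∷ O ∷ O ∷ O ∷ O ∷ []) ∷ (I ∷ X ∷ X ∷ X ∷ O ∷ I ∷ O ∷ []) ∷ []))
K₃-unlinked-b = certified
  (split (split (split (split (split (split (split (split (need 1 0 (need 2 0 (need 0 1 [] ∷ need 0 2 [] ∷ need 3 0
  (need 0 1 [] ∷ []) ∷ need 3 1 [] ∷ []) ∷ need 5 3 (need 3 0 (need 10 6 [] ∷ []) ∷ need 9 5 [] ∷ need 3 1 (need 7 5
  (need 0 2 (need 3 7 [] ∷ need 6 8 [] ∷ need 6 8 [] ∷ []) ∷ []) ∷ need 2 3 [] ∷ need 4 2 [] ∷ []) ∷ []) ∷ need 2 1
  (need 0 1 [] ∷ []) ∷ []) ∷ need 1 0 (need 2 0 (need 0 1 [] ∷ need 0 2 [] ∷ need 3 1 (need 0 1 (need 0 1 (need 3 2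
  (need 7 3 [] ∷ []) ∷ []) ∷ []) ∷ need 4 2 [] ∷ []) ∷ need 3 1 (need 0 1 (need 2 1 (need 6 2 [] ∷ []) ∷ []) ∷ need
  4 2 [] ∷ []) ∷ need 3 1 [] ∷ []) ∷ need 2 5 (need 1 2 (need 5 2 [] ∷ []) ∷ need 3 2 (need 0 3 [] ∷ []) ∷ need 1 2
  (need 6 7 [] ∷ []) ∷ need 3 2 (need 0 3 [] ∷ []) ∷ need 9 5 [] ∷ need 3 0 (need 0 2 [] ∷ []) ∷ need 3 0 (need 0 2
  [] ∷ []) ∷ []) ∷ need 2 1 (need 0 1 (need 5 3 [] ∷ []) ∷ []) ∷ need 2 1 (need 0 1 (need 2 1 (need 5 4 [] ∷ []) ∷
  []) ∷ []) ∷ []) ∷ []) ∷ []) ∷ []) ∷ []) ∷ []) ∷ []) ∷ []) ∷ []))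
  refl

K₃-unlinked-m : Refuted true (K₃-config ((O ∷ O ∷ O ∷ O ∷ O ∷ O ∷ []) ∷ (I ∷ X ∷ X ∷ X ∷ I ∷ O ∷ O ∷ []) ∷ []))
K₃-unlinked-m = certified
  (split (split (split (split (split (split (split (split (need 4 2 (need 2 1 (need 3 0 (need 0 1 [] ∷ need 0 3 [] ∷
  need 4 0 (need 0 1 [] ∷ []) ∷ need 4 1 [] ∷ []) ∷ need 3 4 (need 10 6 [] ∷ []) ∷ need 3 4 [] ∷ []) ∷ need 5 3
  (need 3 2 (need 4 0 (need 0 1 [] ∷ need 0 4 [] ∷ need 2 3 (need 0 2 (need 5 4 [] ∷ []) ∷ []) ∷ need 3 6 [] ∷ need
  2 6 [] ∷ need 5 1 (need 0 1 (need 4 5 [] ∷ []) ∷ need 6 2 [] ∷ []) ∷ need 2 3 [] ∷ need 5 1 (need 0 1 (need 4 8 []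
  ∷ []) ∷ need 6 2 [] ∷ []) ∷ need 5 1 (need 0 1 (need 5 8 [] ∷ []) ∷ need 6 2 [] ∷ []) ∷ need 5 1 (need 0 1 (need 4
  5 [] ∷ []) ∷ need 6 2 [] ∷ []) ∷ need 5 1 [] ∷ []) ∷ need 0 3 (need 2 3 [] ∷ need 5 2 (need 12 8 [] ∷ need 3 4 []
  ∷ []) ∷ need 5 2 (need 1 0 [] ∷ []) ∷ need 5 2 (need 1 0 [] ∷ []) ∷ need 5 2 (need 1 0 [] ∷ []) ∷ []) ∷ need 1 2
  (need 0 2 (need 4 3 [] ∷ []) ∷ []) ∷ need 2 5 [] ∷ need 1 5 [] ∷ need 4 1 (need 6 0 [] ∷ []) ∷ need 1 2 [] ∷ need
  4 1 (need 3 0 [] ∷ []) ∷ need 4 2 (need 2 0 [] ∷ []) ∷ need 4 1 (need 5 0 (need 0 2 [] ∷ []) ∷ []) ∷ []) ∷ need 6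
  5 (need 0 1 [] ∷ need 4 1 (need 3 6 [] ∷ need 5 2 (need 0 1 [] ∷ []) ∷ need 5 2 (need 0 1 [] ∷ []) ∷ need 5 2
  (need 0 1 [] ∷ []) ∷ []) ∷ need 4 1 (need 0 4 [] ∷ need 5 0 (need 0 1 [] ∷ []) ∷ []) ∷ []) ∷ need 6 5 (need 0 8
  (need 0 7 [] ∷ []) ∷ []) ∷ []) ∷ need 5 3 (need 0 1 [] ∷ need 6 5 (need 0 8 [] ∷ []) ∷ []) ∷ need 5 3 [] ∷ []) ∷
  need 1 0 (need 7 3 (need 1 2 [] ∷ need 9 5 [] ∷ need 3 0 (need 10 6 [] ∷ []) ∷ need 9 5 [] ∷ need 8 4 (need 0 1
  (need 2 6 [] ∷ need 5 8 [] ∷ need 5 8 [] ∷ []) ∷ []) ∷ []) ∷ need 2 1 (need 0 1 [] ∷ need 3 0 (need 0 1 [] ∷ []) ∷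
  []) ∷ need 2 1 (need 0 1 [] ∷ []) ∷ []) ∷ []) ∷ []) ∷ []) ∷ []) ∷ []) ∷ []) ∷ []) ∷ []))
  refl

K₃-unlinked-y : Refuted true (K₃-config ((I ∷ O ∷ O ∷ O ∷ O ∷ O ∷ []) ∷ []))
K₃-unlinked-y = certified
  (split (split (split (split (split (split (split (need 0 1 (need 1 0 (need 0 1 [] ∷ need 0 3 [] ∷ need 2 1 (need 0
  1 (need 0 1 (need 3 2 (need 6 3 [] ∷ []) ∷ []) ∷ []) ∷ need 3 2 [] ∷ []) ∷ need 2 1 [] ∷ []) ∷ need 1 4 (need 1 3
  (need 5 6 [] ∷ []) ∷ need 2 3 (need 0 4 [] ∷ []) ∷ need 8 4 [] ∷ need 2 0 (need 0 2 [] ∷ []) ∷ []) ∷ need 1 2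
  (need 0 1 (need 0 1 (need 3 2 (need 5 6 [] ∷ []) ∷ []) ∷ []) ∷ []) ∷ []) ∷ []) ∷ []) ∷ []) ∷ []) ∷ []) ∷ []) ∷
  []))
  refl

-- From here on `p` is the last prescribed vertex; `-x` means that it sees `x`, and `-x′` that it
-- sees `x′` but not `x`.
K₃-undominated-m-x : Refuted true (K₃-config ((X ∷ O ∷ O ∷ I ∷ O ∷ O ∷ []) ∷ (X ∷ X ∷ X ∷ I ∷ O ∷ O ∷ O ∷ []) ∷ []))
K₃-undominated-m-x = certified
  (split (split (split (split (split (split (split (split (need 0 2 (need 0 1 [] ∷ need 4 5 [] ∷ need 1 4 (need 0 6
  (need 4 9 (need 4 3 (need 0 4 [] ∷ need 5 0 (need 0 1 [] ∷ []) ∷ []) ∷ []) ∷ []) ∷ need 0 4 (need 0 1 [] ∷ need 0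
  5 [] ∷ []) ∷ []) ∷ []) ∷ []) ∷ []) ∷ []) ∷ []) ∷ []) ∷ []) ∷ []) ∷ []))
  refl

K₃-undominated-m-x′ : Refuted true (K₃-config ((X ∷ O ∷ O ∷ I ∷ O ∷ O ∷ []) ∷ (X ∷ X ∷ I ∷ O ∷ O ∷ O ∷ O ∷ []) ∷ []))
K₃-undominated-m-x′ = certified
  (split (split (split (split (split (split (split (split (need 0 4 (need 1 0 (need 0 4 [] ∷ []) ∷ need 2 7 (need 0
  7 (need 0 1 (need 0 6 (need 1 0 (need 0 1 [] ∷ need 2 0 (need 0 1 [] ∷ []) ∷ []) ∷ []) ∷ need 1 0 (need 0 1 [] ∷
  need 0 7 [] ∷ []) ∷ need 0 6 [] ∷ []) ∷ []) ∷ need 3 0 [] ∷ []) ∷ need 1 0 (need 2 0 (need 0 1 [] ∷ []) ∷ []) ∷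
  []) ∷ []) ∷ []) ∷ []) ∷ []) ∷ []) ∷ []) ∷ []) ∷ []))
  refl

K₃-undominated-b-x : Refuted true (K₃-config ((X ∷ O ∷ O ∷ O ∷ I ∷ O ∷ []) ∷ (X ∷ X ∷ X ∷ I ∷ O ∷ O ∷ O ∷ []) ∷ []))
K₃-undominated-b-x = certified
  (split (split (split (split (split (split (split (split (need 0 2 (need 0 1 [] ∷ need 2 0 (need 2 5 (need 0 7
  (need 4 1 (need 0 3 [] ∷ need 0 4 [] ∷ need 6 10 [] ∷ []) ∷ []) ∷ []) ∷ need 0 3 [] ∷ need 7 8 [] ∷ []) ∷ need 4 5
  [] ∷ need 1 0 (need 2 0 (need 0 1 [] ∷ []) ∷ []) ∷ []) ∷ need 3 4 [] ∷ []) ∷ split (need 5 6 [] ∷ need 0 2 (need 1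
  0 (need 0 1 [] ∷ []) ∷ []) ∷ []) ∷ []) ∷ []) ∷ []) ∷ []) ∷ []) ∷ []) ∷ []))
  refl

K₃-undominated-b-x′ : Refuted true (K₃-config ((X ∷ O ∷ O ∷ O ∷ I ∷ O ∷ []) ∷ (X ∷ X ∷ I ∷ O ∷ O ∷ O ∷ O ∷ []) ∷ []))
K₃-undominated-b-x′ = certified
  (split (split (split (split (split (split (split (split (need 1 2 (need 1 5 (need 3 7 (need 0 9 (need 5 3 (need 0
  4 [] ∷ need 6 0 (need 0 1 [] ∷ []) ∷ []) ∷ []) ∷ need 4 0 [] ∷ []) ∷ need 2 0 (need 0 5 [] ∷ []) ∷ []) ∷ need 0 2
  [] ∷ need 6 7 [] ∷ []) ∷ []) ∷ split [] ∷ []) ∷ []) ∷ []) ∷ []) ∷ []) ∷ []) ∷ []))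
  refl

K₃-triangle-x : Refuted true (K₃-config ((I ∷ O ∷ I ∷ I ∷ O ∷ O ∷ []) ∷ (X ∷ X ∷ X ∷ I ∷ O ∷ O ∷ O ∷ []) ∷ []))
K₃-triangle-x = certified
  (split (split (split (split (split (split (split (split (need 0 4 (need 1 4 (need 2 0 (need 0 2 [] ∷ []) ∷ []) ∷
  need 1 2 (need 2 0 (need 0 2 [] ∷ []) ∷ []) ∷ []) ∷ []) ∷ []) ∷ []) ∷ []) ∷ []) ∷ []) ∷ []) ∷ []))
  refl

K₃-triangle-x′ : Refuted true (K₃-config ((I ∷ O ∷ I ∷ I ∷ O ∷ O ∷ []) ∷ (X ∷ X ∷ I ∷ O ∷ O ∷ O ∷ O ∷ []) ∷ []))
K₃-triangle-x′ = certified
  (split (split (split (split (split (split (split (split [] ∷ []) ∷ []) ∷ []) ∷ []) ∷ []) ∷ []) ∷ []))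
  refl

K₃-crossing-b-x : Refuted true (K₃-config ((O ∷ O ∷ O ∷ O ∷ O ∷ I ∷ []) ∷ (I ∷ X ∷ X ∷ I ∷ O ∷ I ∷ O ∷ []) ∷ (X ∷ X ∷ X ∷ X ∷ I ∷ O ∷ O ∷ O ∷ []) ∷ []))
K₃-crossing-b-x = certified
  (split (split (split (split (split (split (split (split (split (need 0 3 (need 0 1 [] ∷ need 1 5 (need 8 9 (need 9
  0 [] ∷ []) ∷ []) ∷ need 5 6 [] ∷ need 5 6 (need 6 0 [] ∷ []) ∷ []) ∷ need 4 5 (need 5 0 (need 0 1 [] ∷ []) ∷ []) ∷
  need 4 5 [] ∷ need 4 5 (need 5 0 (need 0 1 [] ∷ []) ∷ []) ∷ []) ∷ []) ∷ []) ∷ []) ∷ []) ∷ []) ∷ []) ∷ []) ∷ []))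
  refl

K₃-crossing-b-x′ : Refuted true (K₃-config ((O ∷ O ∷ O ∷ O ∷ O ∷ I ∷ []) ∷ (I ∷ X ∷ X ∷ I ∷ O ∷ I ∷ O ∷ []) ∷ (X ∷ X ∷ X ∷ I ∷ O ∷ O ∷ O ∷ O ∷ []) ∷ []))
K₃-crossing-b-x′ = certified
  (split (split (split (split (split (split (split (split (split (need 1 0 (need 3 1 (need 4 0 (need 0 1 [] ∷ need 2
  1 [] ∷ []) ∷ need 4 0 [] ∷ []) ∷ []) ∷ []) ∷ []) ∷ []) ∷ []) ∷ []) ∷ []) ∷ []) ∷ []) ∷ []))
  refl

K₃-crossing-m-x : Refuted true (K₃-config ((O ∷ O ∷ O ∷ O ∷ O ∷ I ∷ []) ∷ (I ∷ X ∷ X ∷ I ∷ I ∷ O ∷ O ∷ []) ∷ (X ∷ X ∷ X ∷ X ∷ I ∷ O ∷ O ∷ O ∷ []) ∷ []))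
K₃-crossing-m-x = certified
  (split (split (split (split (split (split (split (split (split (need 0 1 (need 0 1 [] ∷ need 1 5 (need 6 1 (need 0
  2 [] ∷ []) ∷ need 0 7 (need 3 6 (need 4 0 (need 0 1 [] ∷ need 0 4 [] ∷ need 7 11 [] ∷ []) ∷ []) ∷ []) ∷ []) ∷ need
  5 6 [] ∷ need 5 6 [] ∷ []) ∷ need 1 8 (need 5 6 [] ∷ []) ∷ []) ∷ split (need 0 4 (need 0 1 [] ∷ need 1 0 [] ∷ need
  1 0 (need 2 0 (need 0 1 [] ∷ []) ∷ []) ∷ []) ∷ []) ∷ []) ∷ []) ∷ []) ∷ []) ∷ []) ∷ []) ∷ []) ∷ []))
  refl

K₃-crossing-m-x′ : Refuted true (K₃-config ((O ∷ O ∷ O ∷ O ∷ O ∷ I ∷ []) ∷ (I ∷ X ∷ X ∷ I ∷ I ∷ O ∷ O ∷ []) ∷ (X ∷ X ∷ X ∷ I ∷ O ∷ O ∷ O ∷ O ∷ []) ∷ []))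
K₃-crossing-m-x′ = certified
  (split (split (split (split (split (split (split (split (split (need 2 6 (need 1 6 (need 2 0 (need 0 1 (need 1 0
  (need 0 5 [] ∷ []) ∷ []) ∷ need 0 4 [] ∷ need 0 6 [] ∷ []) ∷ []) ∷ need 3 0 (need 0 3 [] ∷ []) ∷ []) ∷ need 2 8
  (need 3 9 (need 9 5 (need 1 2 [] ∷ need 0 6 [] ∷ []) ∷ []) ∷ []) ∷ []) ∷ split [] ∷ []) ∷ []) ∷ []) ∷ []) ∷ []) ∷
  []) ∷ []) ∷ []))
  refl

K₃-edge-x : Refuted true (K₃-config ((O ∷ O ∷ O ∷ O ∷ O ∷ I ∷ []) ∷ (I ∷ O ∷ O ∷ O ∷ O ∷ O ∷ I ∷ []) ∷ (X ∷ X ∷ X ∷ X ∷ I ∷ O ∷ O ∷ O ∷ []) ∷ []))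
K₃-edge-x = certified
  (split (split (split (split (split (split (split (split (split (need 4 5 (need 2 3 [] ∷ need 2 3 [] ∷ need 1 4 []
  ∷ need 1 4 [] ∷ need 1 4 [] ∷ []) ∷ need 1 2 [] ∷ []) ∷ []) ∷ []) ∷ []) ∷ []) ∷ []) ∷ []) ∷ []) ∷ []))
  refl

K₃-edge-x′ : Refuted true (K₃-config ((O ∷ O ∷ O ∷ O ∷ O ∷ I ∷ []) ∷ (I ∷ O ∷ O ∷ O ∷ O ∷ O ∷ I ∷ []) ∷ (X ∷ X ∷ X ∷ I ∷ O ∷ O ∷ O ∷ O ∷ []) ∷ []))
K₃-edge-x′ = certified
  (split (split (split (split (split (split (split (split (split (need 1 2 [] ∷ []) ∷ []) ∷ []) ∷ []) ∷ []) ∷ []) ∷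
  []) ∷ []) ∷ []))
  refl

-- Counting, fresh elements and transpositions.

size : ∀ {n} {P : Pred (Fin n) 0ℓ} → Decidable P → ℕ
size {zero} P? = 0
size {suc n} P? = (if does (P? zero) then 1 else 0) + size (P? ∘ suc)

size-mono : ∀ {n} {P Q : Pred (Fin n) 0ℓ} (P? : Decidable P) (Q? : Decidable Q) → (∀ v → P v → Q v) → size P? ≤ size Q?
size-mono {zero} P? Q? P⊆Q = z≤n
size-mono {suc n} P? Q? P⊆Q with P? zero | Q? zero
... | yes p | yes q = s≤s (size-mono (P? ∘ suc) (Q? ∘ suc) (P⊆Q ∘ suc))
... | yes p | no ¬q = ⊥-elim (¬q (P⊆Q zero p))
... | no ¬p | yes q = ≤-trans (size-mono (P? ∘ suc) (Q? ∘ suc) (P⊆Q ∘ suc)) (n≤1+n _)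
... | no ¬p | no ¬q = size-mono (P? ∘ suc) (Q? ∘ suc) (P⊆Q ∘ suc)

size-< : ∀ {n} {P Q : Pred (Fin n) 0ℓ} (P? : Decidable P) (Q? : Decidable Q) → (∀ v → P v → Q v) →
  ∀ v → Q v → ¬ P v → size P? < size Q?
size-< {suc n} P? Q? P⊆Q zero q ¬p with P? zero | Q? zero
... | yes p | _ = ⊥-elim (¬p p)
... | no _ | yes _ = s≤s (size-mono (P? ∘ suc) (Q? ∘ suc) (P⊆Q ∘ suc))
... | no _ | no ¬q = ⊥-elim (¬q q)
size-< {suc n} P? Q? P⊆Q (suc v) q ¬p with P? zero | Q? zero
... | yes _ | yes _ = s≤s (size-< (P? ∘ suc) (Q? ∘ suc) (P⊆Q ∘ suc) v q ¬p)
... | yes p | no ¬q = ⊥-elim (¬q (P⊆Q zero p))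
... | no _ | yes _ = ≤-trans (size-< (P? ∘ suc) (Q? ∘ suc) (P⊆Q ∘ suc) v q ¬p) (n≤1+n _)
... | no _ | no _ = size-< (P? ∘ suc) (Q? ∘ suc) (P⊆Q ∘ suc) v q ¬p

-- If all values lay in `L`, their positions would map `Fin k` injectively into fewer than `k`
-- places. This supplies free colours as well as clique vertices outside a given list.
fresh : ∀ {k m} (f : Fin k → Fin m) → (∀ {i j} → f i ≡ f j → i ≡ j) → ∀ L → length L < k → ∃ λ i → f i ∉ L
fresh {k} f injective L short = ¬∀⟶∃¬ k (λ i → f i ∈ L) (λ i → _∈?_ _≟_ (f i) L) λ all∈ →
  let i , j , i<j , eq = pigeonhole short (λ i → index (all∈ i))
  in <⇒≢ i<j (injective (Membership.index-injective (setoid _) (all∈ i) (all∈ j) eq))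

transpose-hit : ∀ {k} (i j : Fin k) → transpose i j i ≡ j
transpose-hit i j rewrite dec-true (i ≟ i) refl = refl

transpose-miss : ∀ {k} (i j l : Fin k) → l ≢ i → l ≢ j → transpose i j l ≡ l
transpose-miss i j l l≢i l≢j rewrite dec-false (l ≟ i) l≢i | dec-false (l ≟ j) l≢j = refl

transpose-injective : ∀ {k} (i j : Fin k) {l m} → transpose i j l ≡ transpose i j m → l ≡ m
transpose-injective i j eq = trans (sym (transpose-inverse j i)) (trans (cong (transpose j i) eq) (transpose-inverse j i))

-- Colourings of decidable vertex sets.

module Colouring {n} (G : Graph n) where

  V = Fin n

  infix 4 _~_ _≁_
  _~_ _≁_ : V → V → Set
  u ~ v = adj G u v ≡ true
  u ≁ v = adj G u v ≡ false

  _~?_ : ∀ u v → Dec (u ~ v)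
  u ~? v = adj G u v Bool.≟ true

  _≁?_ : ∀ u v → Dec (u ≁ v)
  u ≁? v = adj G u v Bool.≟ false

  ~-sym : ∀ {u v} → u ~ v → v ~ u
  ~-sym {u} {v} = trans (Graph.sym G v u)

  ≁-sym : ∀ {u v} → u ≁ v → v ≁ u
  ≁-sym {u} {v} = trans (Graph.sym G v u)

  clash : ∀ {u v} → u ~ v → u ≁ v → ⊥
  clash e f with () ← trans (sym e) f

  ¬~⇒≁ : ∀ {u v} → ¬ u ~ v → u ≁ v
  ¬~⇒≁ {u} {v} = Bool.¬-not

  ~⇒≢ : ∀ {u v} → u ~ v → u ≢ v
  ~⇒≢ e refl = clash e (irrefl G _)

  Proper : Pred V 0ℓ → ∀ {k} → (V → Fin k) → Set
  Proper P c = ∀ {u v} → P u → P v → u ~ v → c u ≢ c v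

  Col : Pred V 0ℓ → ℕ → Set
  Col P k = Σ (V → Fin k) (Proper P)

  -- The maps `V → Fin k` are enumerated through their codes in a finite set. Decidability is what
  -- allows a constructive passage to a minimal non-colourable set.
  col? : ∀ {P} k → Decidable P → Dec (Col P k)
  col? {P} k P? = map′
    (λ (i , ok) → finToFun i , λ {u} {v} → ok u v)
    (λ (c , ok) → funToFin c , λ u v Pu Pv e eq →
      ok Pu Pv e (trans (sym (finToFun-funToFin c u)) (trans eq (finToFun-funToFin c v))))
    (any? λ i → all? λ u → all? λ v → P? u →-dec P? v →-dec (u ~? v) →-dec ¬? (finToFun {k} {n} i u ≟ finToFun i v))

  col-≤ : ∀ {P j k} → j ≤ k → Col P j → Col P k
  col-≤ j≤k (c , ok) = (λ v → inject≤ (c v) j≤k) , λ Pu Pv e eq → ok Pu Pv e (inject≤-injective _ _ _ _ eq)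

  col-independent : ∀ {P} → (∀ {u v} → P u → P v → u ~ v → ⊥) → Col P 1
  col-independent ind = (λ _ → zero) , λ Pu Pv e _ → ind Pu Pv e

  col-+ : ∀ {U P Q j k} → Decidable P → (∀ v → U v → ¬ P v → Q v) → Col P j → Col Q k → Col U (j + k)
  col-+ {U} {P} {Q} {j} {k} P? cover (c , c-ok) (d , d-ok) = colour , ok
    where
    colour : V → Fin (j + k)
    colour v = if does (P? v) then c v ↑ˡ k else (j ↑ʳ d v)
    disjoint : ∀ {i l} → i ↑ˡ k ≢ j ↑ʳ l
    disjoint {i} {l} eq with () ← trans (sym (splitAt-↑ˡ j i k)) (trans (cong (splitAt j) eq) (splitAt-↑ʳ j k l))
    ok : Proper U colour
    ok {u} {v} Uu Uv e with P? u | P? v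
    ... | yes Pu | yes Pv = c-ok Pu Pv e ∘ ↑ˡ-injective k _ _
    ... | yes Pu | no ¬Pv = disjoint
    ... | no ¬Pu | yes Pv = disjoint ∘ sym
    ... | no ¬Pu | no ¬Pv = d-ok (cover u Uu ¬Pu) (cover v Uv ¬Pv) e ∘ ↑ʳ-injective j _ _

  glue : ∀ {U P Q k} → Decidable P → (∀ v → U v → ¬ P v → Q v) → (p : Col P k) (q : Col Q k) →
    (∀ {u v} → P u → U v → ¬ P v → u ~ v → proj₁ p u ≢ proj₁ q v) → Col U k
  glue {U} {P} {Q} {k} P? cover (c , c-ok) (d , d-ok) cross = colour , ok
    where
    colour : V → Fin k
    colour v = if does (P? v) then c v else d v
    ok : Proper U colour
    ok {u} {v} Uu Uv e with P? u | P? v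
    ... | yes Pu | yes Pv = c-ok Pu Pv e
    ... | yes Pu | no ¬Pv = cross Pu Uv ¬Pv e
    ... | no ¬Pu | yes Pv = cross Pv Uu ¬Pu (~-sym e) ∘ sym
    ... | no ¬Pu | no ¬Pv = d-ok (cover u Uu ¬Pu) (cover v Uv ¬Pv) e

  col-∪ : ∀ {U P Q k} → Decidable P → (∀ v → U v → ¬ P v → Q v) →
    (∀ {u v} → P u → U v → ¬ P v → ¬ u ~ v) → Col P k → Col Q k → Col U k
  col-∪ P? cover none p q = glue P? cover p q λ Pu Uv ¬Pv e _ → none Pu Uv ¬Pv e

  _∖_ : Pred V 0ℓ → V → Pred V 0ℓ
  (P ∖ v) u = P u × u ≢ v

  ∖? : ∀ {P} → Decidable P → ∀ v → Decidable (P ∖ v)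
  ∖? P? v u = P? u ×-dec ¬? (u ≟ v)

  recolour : ∀ {P k} v → (c : Col (P ∖ v) k) (a : Fin k) → (∀ u → P u → u ~ v → proj₁ c u ≢ a) → Col P k
  recolour {P} {k} v (c , ok) a free = glue (_≟ v) (λ u Pu u≢v → Pu , u≢v)
    ((λ _ → a) , λ { refl refl e → ⊥-elim (~⇒≢ e refl) }) (c , ok)
    λ { refl Pu _ e eq → free _ Pu (~-sym e) (sym eq) }

  extend : ∀ {P k} v (L : List V) → length L < k → (∀ u → P u → u ~ v → u ∈ L) → Col (P ∖ v) k → Col P k
  extend {k = k} v L short nbrs (c , ok) =
    let a , a∉ = fresh id id (List.map c L) (subst (_< k) (sym (length-map c L)) short)
    in recolour v (c , ok) a λ u Pu e eq → a∉ (subst (_∈ List.map c L) eq (∈-map⁺ c (nbrs u Pu e)))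

  -- Colourings are total functions on `V`, so even the empty set needs a colour to assign;
  -- `default` provides it.
  greedy : ∀ {P k} → Decidable P → (V → Fin k) → (∀ v → P v → Σ (List V) λ L → length L < k × (∀ u → P u → u ~ v → u ∈ L)) → Col P k
  greedy {P} {k} P? default nbrs = go _ P? (λ _ p → p) ≤-refl
    where
    go : ∀ m {Q} (Q? : Decidable Q) → (∀ v → Q v → P v) → size Q? ≤ m → Col Q k
    go zero Q? Q⊆P empty = default , λ {u} Qu _ _ → ⊥-elim (none u Qu)
      where
      none : ∀ v → ¬ _
      none v Qv with () ← <-≤-trans (size-< {P = λ _ → ⊥} (λ _ → no id) Q? (λ _ ()) v Qv id) empty
    go (suc m) Q? Q⊆P bound with any? Q?
    ... | no none = default , λ Qu _ _ → ⊥-elim (none (_ , Qu))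
    ... | yes (v , Qv) with nbrs v (Q⊆P v Qv)
    ... | L , short , all∈ = extend v L short (λ u Qu → all∈ u (Q⊆P u Qu))
      (go m (∖? Q? v) (λ u → Q⊆P u ∘ proj₁) (s≤s⁻¹ (≤-trans (size-< (∖? Q? v) Q? (λ _ → proj₁) v Qv (λ q → proj₂ q refl)) bound)))

  -- The vertices of `S` are matched one at a time by transposing the colours `d s` and `c s`. A
  -- vertex `t` matched before is not disturbed: its colour differs from `d s` since `d` is proper,
  -- and from `c s` since it equals `c t` and `c` is proper.
  align : ∀ {P Q k} ((c , _) : Col P k) → Col Q k → ∀ S → (∀ {s} → s ∈ S → P s × Q s) →
    (∀ {s t} → s ∈ S → t ∈ S → s ≢ t → s ~ t) → Σ (Col Q k) λ (d , _) → ∀ {s} → s ∈ S → d s ≡ c s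
  align p q [] _ _ = q , λ ()
  align {P} {Q} {k} p@(c , c-ok) q (s ∷ S) in-both clique with align p q S (in-both ∘ there) (λ a b → clique (there a) (there b))
  ... | d′@(d , d-ok) , agree with _∈?_ _≟_ s S
  ... | yes s∈ = d′ , λ { (here refl) → agree s∈ ; (there t∈) → agree t∈ }
  ... | no s∉ = (τ ∘ d , λ Qu Qv e → d-ok Qu Qv e ∘ transpose-injective (d s) (c s)) , λ
    { (here refl) → transpose-hit (d s) (c s)
    ; {t} (there t∈) →
        let t~s = clique (there t∈) (here refl) (λ { refl → s∉ t∈ })
            Pt , Qt = in-both (there t∈)
            Ps , Qs = in-both (here refl)
        in trans (transpose-miss _ _ _ (d-ok Qt Qs t~s) (λ eq → c-ok Pt Ps t~s (trans (sym (agree t∈)) eq))) (agree t∈) }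
    where
    τ = transpose (d s) (c s)

  -- After `align` the two colourings agree on the part of the clique `S` outside `K`. The first is
  -- then used on `K` and the second on the rest, and every edge between them ends in `S`.
  col-cutset : ∀ {U K S k} → Decidable U → Decidable K → Decidable S → (∀ v → K v → U v) →
    (∀ {u v} → S u → S v → u ≢ v → u ~ v) → (∀ {u v} → K u → U v → ¬ K v → u ~ v → S v) →
    Col (λ v → U v × (K v ⊎ S v)) k → Col (λ v → U v × ¬ K v) k → Col U k
  col-cutset {U} {K} {S} U? K? S? K⊆U clique boundary p q =
    let outer : Decidable (λ v → U v × S v × ¬ K v)
        outer v = U? v ×-dec S? v ×-dec ¬? (K? v)
        both : ∀ {s} → s ∈ filter outer (allFin n) → U s × S s × ¬ K s
        both s∈ = proj₂ (∈-filter⁻ outer {xs = allFin n} s∈)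
        (d , d-ok) , agree = align p q (filter outer (allFin n))
          (λ s∈ → let Us , Ss , ¬Ks = both s∈ in (Us , inj₂ Ss) , (Us , ¬Ks))
          (λ s∈ t∈ → clique (proj₁ (proj₂ (both s∈))) (proj₁ (proj₂ (both t∈))))
    in glue K? (λ v Uv ¬Kv → Uv , ¬Kv) (proj₁ p , λ Ku Kv → proj₂ p (K⊆U _ Ku , inj₁ Ku) (K⊆U _ Kv , inj₁ Kv)) (d , d-ok)
      λ {u} {v} Ku Uv ¬Kv e eq → let Sv = boundary Ku Uv ¬Kv e in
        proj₂ p (K⊆U _ Ku , inj₁ Ku) (Uv , inj₂ Sv) e (trans eq (agree (∈-filter⁺ outer (∈-allFin v) (Uv , Sv , ¬Kv))))

  -- Connectedness is encoded as an induction principle from `root`, which avoids paths altogether.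
  record Component (P : Pred V 0ℓ) : Set₁ where
    field
      K : Pred V 0ℓ
      K? : Decidable K
      root : V
      K-root : K root
      K⊆ : ∀ v → K v → P v
      closed : ∀ {u v} → K u → P v → u ~ v → K v
      induct : (R : V → Set) → R root → (∀ {u v} → K u → K v → u ~ v → R u → R v) → ∀ v → K v → R v

    -- Without such an edge `R` or its complement, whichever contains `root`, would spread over all
    -- of `K`.
    crossing : ∀ {R : V → Set} → Decidable R → ∀ {a b} → K a → R a → K b → ¬ R b → ∃₂ λ u v → K u × K v × u ~ v × R u × ¬ R v
    crossing {R} R? {a} {b} Ka Ra Kb ¬Rb
      with any? (λ u → any? λ v → K? u ×-dec K? v ×-dec (u ~? v) ×-dec R? u ×-dec ¬? (R? v))
    ... | yes (u , v , found) = u , v , found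
    ... | no none with R? root
    ... | yes Rr = ⊥-elim (¬Rb (induct R Rr
            (λ {u} {v} Ku Kv e Ru → decidable-stable (R? v) λ ¬Rv → none (u , v , Ku , Kv , e , Ru , ¬Rv)) b Kb))
    ... | no ¬Rr = ⊥-elim (induct (λ v → ¬ R v) ¬Rr
            (λ {u} {v} Ku Kv e ¬Ru Rv → none (v , u , Kv , Ku , ~-sym e , Rv , ¬Ru)) a Ka Ra)

  component : ∀ {P} → Decidable P → ∀ x → P x → Σ (Component P) λ C → Component.K C x
  component {P} P? x Px = go _ (x ∷ []) (here refl) (λ { _ (here refl) → Px })
      (λ { R Rx _ _ (here refl) → Rx }) ≤-refl
    where
    left : ∀ L → Decidable (λ v → P v × v ∉ L)
    left L v = P? v ×-dec ¬? (_∈?_ _≟_ v L)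
    go : ∀ m L → x ∈ L → (∀ v → v ∈ L → P v) →
      ((R : V → Set) → R x → (∀ {u v} → u ∈ L → v ∈ L → u ~ v → R u → R v) → ∀ v → v ∈ L → R v) →
      size (left L) ≤ m → Σ (Component P) λ C → Component.K C x
    go m L x∈ L⊆ ind bound with any? (λ u → any? λ v → _∈?_ _≟_ u L ×-dec (u ~? v) ×-dec left L v)
    ... | no none = record
      { K = _∈ L ; K? = λ v → _∈?_ _≟_ v L ; root = x ; K-root = x∈ ; K⊆ = L⊆ ; induct = ind
      ; closed = λ {u} {v} u∈ Pv e → decidable-stable (_∈?_ _≟_ v L) λ v∉ → none (u , v , u∈ , e , Pv , v∉) } , x∈
    go zero L x∈ L⊆ ind bound | yes (u , v , u∈ , e , Pv , v∉)
      with () ← <-≤-trans (size-< {P = λ _ → ⊥} (λ _ → no id) (left L) (λ _ ()) v (Pv , v∉) id) bound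
    go (suc m) L x∈ L⊆ ind bound | yes (u , v , u∈ , e , Pv , v∉) =
      go m (v ∷ L) (there x∈) (λ { _ (here refl) → Pv ; w (there w∈) → L⊆ w w∈ })
        (λ { R Rx step _ (here refl) → step (there u∈) (here refl) e (ind R Rx (λ a b → step (there a) (there b)) u u∈)
           ; R Rx step w (there w∈) → ind R Rx (λ a b → step (there a) (there b)) w w∈ })
        (s≤s⁻¹ (≤-trans (size-< (left (v ∷ L)) (left L) (λ _ (Pw , w∉) → Pw , w∉ ∘ there) v (Pv , v∉) (λ q → proj₂ q (here refl))) bound))

  -- The uncoloured remainder `Q` stays closed under adjacency within `P`, so each of its components
  -- is a component of `P`, and all of them can share one palette.
  col-components : ∀ {P k} → Decidable P → (V → Fin k) → (∀ (C : Component P) → Col (Component.K C) k) → Col P k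
  col-components {P} {k} P? default each = go _ P? (λ _ p → p) (λ _ Pv _ → Pv) ≤-refl
    where
    go : ∀ m {Q} (Q? : Decidable Q) → (∀ v → Q v → P v) → (∀ {u v} → Q u → P v → u ~ v → Q v) → size Q? ≤ m → Col Q k
    go m Q? Q⊆P closedQ bound with any? Q?
    ... | no none = default , λ Qu _ _ → ⊥-elim (none (_ , Qu))
    go zero Q? Q⊆P closedQ bound | yes (x , Qx)
      with () ← <-≤-trans (size-< {P = λ _ → ⊥} (λ _ → no id) Q? (λ _ ()) x Qx id) bound
    go (suc m) {Q} Q? Q⊆P closedQ bound | yes (x , Qx) with component Q? x Qx
    ... | C , Kx = col-∪ K? (λ v Qv ¬Kv → Qv , ¬Kv) (λ Ku Qv ¬Kv e → ¬Kv (closed Ku Qv e))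
      (each record { K = K ; K? = K? ; root = root ; K-root = K-root ; K⊆ = λ v → Q⊆P v ∘ K⊆ v ; induct = induct
                   ; closed = λ Ku Pv e → closed Ku (closedQ (K⊆ _ Ku) Pv e) e })
      (go m rest? (λ v → Q⊆P v ∘ proj₁)
        (λ (Qu , ¬Ku) Pv e → closedQ Qu Pv e , λ Kv → ¬Ku (closed Kv Qu (~-sym e)))
        (s≤s⁻¹ (≤-trans (size-< rest? Q? (λ _ → proj₁) x Qx (λ q → proj₂ q Kx)) bound)))
      where
      open Component C
      rest? : Decidable (λ v → Q v × ¬ K v)
      rest? v = Q? v ×-dec ¬? (K? v)

-- Structure of (P₆, diamond)-free graphs.

cases₄ : ∀ {P : Fin 4 → Set} → P 0F → P 1F → P 2F → P 3F → ∀ i → P i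
cases₄ a b c d 0F = a
cases₄ a b c d 1F = b
cases₄ a b c d 2F = c
cases₄ a b c d 3F = d

cases₆ : ∀ {P : Fin 6 → Set} → P 0F → P 1F → P 2F → P 3F → P 4F → P 5F → ∀ i → P i
cases₆ a b c d e f 0F = a
cases₆ a b c d e f 1F = b
cases₆ a b c d e f 2F = c
cases₆ a b c d e f 3F = d
cases₆ a b c d e f 4F = e
cases₆ a b c d e f 5F = f

-- No two vertices of P₆ have the same neighbourhood, so a map that reproduces its adjacencies is
-- injective; this is how `no-P₆` obtains distinctness.
P6-twin-free : ∀ i j → (∀ k → P6adj i k ≡ P6adj j k) → i ≡ j
P6-twin-free = from-yes (all? λ i → all? λ j → all? (λ k → P6adj i k Bool.≟ P6adj j k) →-dec (i ≟ j))

module Structure {n} (G : Graph n) (P₆-free : Free P6 G) (diamond-free : Free Diamond G) where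

  open Colouring G public

  no-P₆ : ∀ a b c d e f → a ~ b → b ~ c → c ~ d → d ~ e → e ~ f →
    a ≁ c → a ≁ d → a ≁ e → a ≁ f → b ≁ d → b ≁ e → b ≁ f → c ≁ e → c ≁ f → d ≁ f → ⊥
  no-P₆ a b c d e f ab bc cd de ef ac ad ae af bd be bf ce cf df =
    P₆-free (v , (λ i j eq → P6-twin-free i j λ k → trans (sym (faithful i k)) (trans (cong (λ x → adj G x (v k)) eq) (faithful j k))) , faithful)
    where
    v = lookup (a ∷ b ∷ c ∷ d ∷ e ∷ f ∷ [])
    faithful : ∀ i j → adj G (v i) (v j) ≡ P6adj i j
    faithful = cases₆
      (cases₆ (irrefl G a) ab ac ad ae af)
      (cases₆ (~-sym ab) (irrefl G b) bc bd be bf)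
      (cases₆ (≁-sym ac) (~-sym bc) (irrefl G c) cd ce cf)
      (cases₆ (≁-sym ad) (≁-sym bd) (~-sym cd) (irrefl G d) de df)
      (cases₆ (≁-sym ae) (≁-sym be) (≁-sym ce) (~-sym de) (irrefl G e) ef)
      (cases₆ (≁-sym af) (≁-sym bf) (≁-sym cf) (≁-sym df) (~-sym ef) (irrefl G f))

  no-diamond : ∀ a b x y → a ~ b → a ~ x → b ~ x → a ~ y → b ~ y → x ≢ y → x ≁ y → ⊥
  no-diamond a b x y ab ax bx ay by x≢y xy = diamond-free (v , injective , faithful)
    where
    v = lookup (a ∷ b ∷ x ∷ y ∷ [])
    faithful : ∀ i j → adj G (v i) (v j) ≡ Dadj i j
    faithful = cases₄
      (cases₄ (irrefl G a) ab ax ay)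
      (cases₄ (~-sym ab) (irrefl G b) bx by)
      (cases₄ (~-sym ax) (~-sym bx) (irrefl G x) xy)
      (cases₄ (~-sym ay) (~-sym by) (≁-sym xy) (irrefl G y))
    differ : ∀ {p q i j} → p ≢ q → p ≡ q → i ≡ j
    differ p≢q eq = ⊥-elim (p≢q eq)
    injective : ∀ i j → v i ≡ v j → i ≡ j
    injective = cases₄
      (cases₄ (const refl) (differ (~⇒≢ ab)) (differ (~⇒≢ ax)) (differ (~⇒≢ ay)))
      (cases₄ (differ (~⇒≢ (~-sym ab))) (const refl) (differ (~⇒≢ bx)) (differ (~⇒≢ by)))
      (cases₄ (differ (~⇒≢ (~-sym ax))) (differ (~⇒≢ (~-sym bx))) (const refl) (differ x≢y))
      (cases₄ (differ (~⇒≢ (~-sym ay))) (differ (~⇒≢ (~-sym by))) (differ (≢-sym x≢y)) (const refl))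

  -- The positive form of diamond-freeness: the common neighbours of an edge form a clique, so each
  -- edge lies in exactly one maximal clique.
  common-nbrs : ∀ {a b x y} → a ~ b → a ~ x → b ~ x → a ~ y → b ~ y → x ≢ y → x ~ y
  common-nbrs {x = x} {y} ab ax bx ay by x≢y =
    decidable-stable (x ~? y) λ ¬xy → no-diamond _ _ x y ab ax bx ay by x≢y (¬~⇒≁ ¬xy)

  TriangleFree : Pred V 0ℓ → Set
  TriangleFree P = ∀ {a b c} → P a → P b → P c → a ~ b → a ~ c → b ~ c → ⊥

  module Attached {P} (C : Component P) (x : V)
    (no-P₄ : ∀ {a b c} → Component.K C a → Component.K C b → Component.K C c → x ~ a → a ~ b → b ~ c → x ≁ b → x ≁ c → a ≁ c → ⊥)
    {d₀ : V} (Kd₀ : Component.K C d₀) (x~d₀ : x ~ d₀) where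

    open Component C

    -- By `crossing`, some edge `u v` of `K` would leave the set of vertices within distance two of
    -- `x`, and `x d u v` would be an induced path.
    dominated : ∀ {e} → K e → x ≁ e → ∃ λ d → K d × x ~ d × d ~ e
    dominated {e} Ke x≁e = answer
      where
      R : V → Set
      R v = x ~ v ⊎ ∃ λ d → K d × x ~ d × d ~ v
      R? : Decidable R
      R? v = (x ~? v) ⊎-dec any? λ d → K? d ×-dec (x ~? d) ×-dec (d ~? v)
      answer : ∃ λ d → K d × x ~ d × d ~ e
      answer with R? e
      ... | yes (inj₁ x~e) = ⊥-elim (clash x~e x≁e)
      ... | yes (inj₂ found) = found
      ... | no ¬Re with crossing R? Kd₀ (inj₁ x~d₀) Ke ¬Re
      ... | u , v , Ku , Kv , u~v , inj₁ x~u , ¬Rv = ⊥-elim (¬Rv (inj₂ (u , Ku , x~u , u~v)))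
      ... | u , v , Ku , Kv , u~v , inj₂ (d , Kd , x~d , d~u) , ¬Rv with x ~? u
      ... | yes x~u = ⊥-elim (¬Rv (inj₂ (u , Ku , x~u , u~v)))
      ... | no x≁u = ⊥-elim (no-P₄ Kd Ku Kv x~d d~u u~v (¬~⇒≁ x≁u) (¬~⇒≁ (¬Rv ∘ inj₁)) (¬~⇒≁ λ d~v → ¬Rv (inj₂ (d , Kd , x~d , d~v))))

    module _ (tf : TriangleFree K) where

      -- A common neighbour `d` of `x` and `e` either closes a triangle with `e f` or starts the
      -- induced path `x d e f`.
      far-independent : ∀ {e f} → K e × x ≁ e → K f × x ≁ f → e ~ f → ⊥
      far-independent {e} {f} (Ke , x≁e) (Kf , x≁f) e~f with dominated Ke x≁e
      ... | d , Kd , x~d , d~e with d ~? f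
      ... | yes d~f = tf Kd Ke Kf d~e d~f e~f
      ... | no d≁f = no-P₄ Kd Ke Kf x~d d~e e~f x≁e x≁f (¬~⇒≁ d≁f)

      near? : Decidable (λ v → K v × x ~ v)
      near? v = K? v ×-dec (x ~? v)

      col-2 : (∀ {u v} → K u → K v → x ~ u → x ~ v → u ~ v → ⊥) → Col K 2
      col-2 near-independent = col-+ near? (λ v Kv ¬near → Kv , ¬~⇒≁ λ x~v → ¬near (Kv , x~v))
        (col-independent λ (Ku , x~u) (Kv , x~v) → near-independent Ku Kv x~u x~v)
        (col-independent far-independent)

      -- The neighbours of `x` in `K` may span edges if `x` lies outside `K`, but only a matching:
      -- two neighbours of `v` among them are adjacent by `common-nbrs` on the edge `x v`, which
      -- gives a triangle in `K`. So they need two colours, and the non-neighbours of `x` one.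
      col-3 : Col K 3
      col-3 = col-+ near? (λ v Kv ¬near → Kv , ¬~⇒≁ λ x~v → ¬near (Kv , x~v))
        (greedy near? (const zero) matching) (col-independent far-independent)
        where
        matching : ∀ v → K v × x ~ v → Σ (List V) λ L → length L < 2 × (∀ u → K u × x ~ u → u ~ v → u ∈ L)
        matching v (Kv , x~v) with any? (λ u → near? u ×-dec (u ~? v))
        ... | no none = [] , s≤s z≤n , λ u near u~v → ⊥-elim (none (u , near , u~v))
        ... | yes (w , (Kw , x~w) , w~v) = w ∷ [] , s≤s (s≤s z≤n) , unique
          where
          unique : ∀ u → K u × x ~ u → u ~ v → u ∈ w ∷ []
          unique u (Ku , x~u) u~v with u ≟ w
          ... | yes refl = here refl
          ... | no u≢w = ⊥-elim (tf Ku Kw Kv (common-nbrs x~v x~u (~-sym u~v) x~w (~-sym w~v) u≢w) u~v w~v)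

  -- Gyárfás' path argument: v and u ∈ N(v) and d ∈ N(u) start an induced path into a component of what is left.
  triangle-free-4-colourable : ∀ {P} → Decidable P → TriangleFree P → Col P 4
  triangle-free-4-colourable {P} P? tf = col-components P? (const zero) layer₁
    where
    layer₁ : ∀ (C : Component P) → Col (Component.K C) 4
    layer₁ C = col-+ near? (λ v Kv ¬near → Kv , ¬~⇒≁ λ r~v → ¬near (Kv , r~v))
        (col-independent λ (Ku , r~u) (Kv , r~v) u~v → tfK Ku Kv K-root u~v (~-sym r~u) (~-sym r~v))
        -- All neighbours of `root` in `K` have the first colour, so `root` shares the other three
        -- with the far vertices; `layer₂` splits these three as 1 + 2.
        (col-∪ (_≟ root) (λ v (Kv , r≁v) v≢r → Kv , r≁v , v≢r) (λ { refl (_ , r≁v) _ e → clash e r≁v })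
          ((const zero) , λ { refl refl e → ⊥-elim (~⇒≢ e refl) })
          (col-components far? (const zero) layer₂))
      where
      open Component C
      tfK : TriangleFree K
      tfK Ka Kb Kc = tf (K⊆ _ Ka) (K⊆ _ Kb) (K⊆ _ Kc)
      near? : Decidable (λ v → K v × root ~ v)
      near? v = K? v ×-dec (root ~? v)
      Far : Pred V 0ℓ
      Far v = K v × root ≁ v × v ≢ root
      far? : Decidable Far
      far? v = K? v ×-dec (root ≁? v) ×-dec ¬? (v ≟ root)
      layer₂ : ∀ (D : Component Far) → Col (Component.K D) 3
      layer₂ D with crossing (Component.K? D) (proj₁ (Component.K⊆ D _ (Component.K-root D))) (Component.K-root D) K-root
        (λ Dr → proj₂ (proj₂ (Component.K⊆ D _ Dr)) refl)
      ... | a , u , Ka , Ku , a~u , Da , ¬Du = col-+ nearu? (λ v Dv ¬near → Dv , ¬~⇒≁ λ u~v → ¬near (Dv , u~v))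
          (col-independent λ (Dv , u~v) (Dw , u~w) v~w → tfK Ku (proj₁ (D⊆ _ Dv)) (proj₁ (D⊆ _ Dw)) u~v u~w v~w)
          (col-components faru? (const zero) layer₃)
        where
        open Component D using () renaming (K to D′; K? to D?; K⊆ to D⊆; closed to D-closed; crossing to D-crossing)
        r~u : root ~ u
        r~u with root ~? u
        ... | yes e = e
        -- Otherwise `u` would be far from `root` and join `D` through `a`; it is not `root` itself,
        -- which does not see `a`.
        ... | no r≁u = ⊥-elim (¬Du (D-closed Da (Ku , ¬~⇒≁ r≁u , λ { refl → clash a~u (≁-sym (proj₁ (proj₂ (D⊆ a Da)))) }) a~u))
        nearu? : Decidable (λ v → D′ v × u ~ v)
        nearu? v = D? v ×-dec (u ~? v)
        Faru : Pred V 0ℓ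
        Faru v = D′ v × u ≁ v
        faru? : Decidable Faru
        faru? v = D? v ×-dec (u ≁? v)
        layer₃ : ∀ (E : Component Faru) → Col (Component.K E) 2
        layer₃ E with D-crossing (Component.K? E) (proj₁ (Component.K⊆ E _ (Component.K-root E))) (Component.K-root E) Da
          (λ Ea → clash (~-sym a~u) (proj₂ (Component.K⊆ E a Ea)))
        ... | b , d , Db , Dd , b~d , Eb , ¬Ed = Attached.col-2 E d no-P₄ Eb (~-sym b~d)
            (λ Ea Eb Ec → tfK (inK Ea) (inK Eb) (inK Ec))
            (λ Ev Ew d~v d~w v~w → tfK (proj₁ (D⊆ d Dd)) (inK Ev) (inK Ew) d~v d~w v~w)
          where
          inK : ∀ {v} → Component.K E v → K v
          inK Ev = proj₁ (D⊆ _ (proj₁ (Component.K⊆ E _ Ev)))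
          r≁ : ∀ {v} → D′ v → root ≁ v
          r≁ Dv = proj₁ (proj₂ (D⊆ _ Dv))
          u~d : u ~ d
          u~d with u ~? d
          ... | yes e = e
          ... | no u≁d = ⊥-elim (¬Ed (Component.closed E Eb (Dd , ¬~⇒≁ u≁d) b~d))
          no-P₄ : ∀ {a b c} → Component.K E a → Component.K E b → Component.K E c → d ~ a → a ~ b → b ~ c → d ≁ b → d ≁ c → a ≁ c → ⊥
          no-P₄ {a} {b} {c} Ea Eb Ec d~a a~b b~c d≁b d≁c a≁c =
            let Da , u≁a = Component.K⊆ E a Ea ; Db , u≁b = Component.K⊆ E b Eb ; Dc , u≁c = Component.K⊆ E c Ec in
            no-P₆ root u d a b c r~u u~d d~a a~b b~c (r≁ Dd) (r≁ Da) (r≁ Db) (r≁ Dc) u≁a u≁b u≁c d≁b d≁c a≁c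

-- Cyclic predecessor, a permutation of the palette without fixed points as soon as there are two
-- colours.
rotate : ∀ {k} → Fin k → Fin k
rotate {suc k} zero = fromℕ k
rotate (suc i) = inject₁ i

rotate-injective : ∀ {k} {i j : Fin k} → rotate i ≡ rotate j → i ≡ j
rotate-injective {i = zero} {zero} _ = refl
rotate-injective {i = zero} {suc j} eq = ⊥-elim (fromℕ≢inject₁ eq)
rotate-injective {i = suc i} {zero} eq = ⊥-elim (fromℕ≢inject₁ (sym eq))
rotate-injective {i = suc i} {suc j} eq = cong suc (inject₁-injective eq)

rotate-moves : ∀ {k} (i : Fin (2 + k)) → i ≢ rotate i
rotate-moves (suc i) eq = 1+n≢n (trans (cong toℕ eq) (toℕ-inject₁ i))

-- Origin of the five: at most `w − 2` common neighbours together with four listed vertices stay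
-- below the degree bound `w + 3`.
quota-bound : ∀ {c l w} → 2 + c ≤ w → l < 5 → c + l < w + 3
quota-bound {c} {l} {w} c≤ l< = s≤s⁻¹ (s≤s⁻¹ (subst₂ _≤_ (cong (2 +_) (+-suc c l)) (trans (+-suc w 4) (cong suc (+-suc w 3))) (+-mono-≤ c≤ l<)))

module Clique {n} (G : Graph n) where

  open Colouring G

  pairwise : ∀ {L} → Unique L → (∀ {a b} → a ∈ L → b ∈ L → a ≢ b → a ~ b) → AllPairs _~_ L
  pairwise [] _ = []
  pairwise (a∉ ∷ u) clique = All.tabulate (λ b∈ → clique (here refl) (there b∈) (All.lookup a∉ b∈)) ∷ pairwise u (λ a b → clique (there a) (there b))

  pairwise-lookup : ∀ {L} → AllPairs _~_ L → ∀ i j → i ≢ j → List.lookup L i ~ List.lookup L j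
  pairwise-lookup (_ ∷ _) zero zero i≢j = ⊥-elim (i≢j refl)
  pairwise-lookup (e ∷ _) zero (suc j) _ = All.lookup e (∈-lookup j)
  pairwise-lookup (e ∷ _) (suc i) zero _ = ~-sym (All.lookup e (∈-lookup i))
  pairwise-lookup (_ ∷ p) (suc i) (suc j) i≢j = pairwise-lookup p i j (i≢j ∘ cong suc)

  members : ∀ {P : Pred V 0ℓ} → Decidable P → List V
  members P? = filter P? (allFin n)

  ∈-members⁺ : ∀ {P : Pred V 0ℓ} (P? : Decidable P) {v} → P v → v ∈ members P?
  ∈-members⁺ P? = ∈-filter⁺ P? (∈-allFin _)

  ∈-members⁻ : ∀ {P : Pred V 0ℓ} (P? : Decidable P) {v} → v ∈ members P? → P v
  ∈-members⁻ P? = proj₂ ∘ ∈-filter⁻ P? {xs = allFin n}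

  members-clique : ∀ {P : Pred V 0ℓ} (P? : Decidable P) → (∀ {a b} → P a → P b → a ≢ b → a ~ b) → AllPairs _~_ (members P?)
  members-clique P? clique = pairwise (filter⁺ P? (allFin⁺ n)) λ a∈ b∈ → clique (∈-members⁻ P? a∈) (∈-members⁻ P? b∈)

-- Minimal counterexamples.

module Minimal {n} (G : Graph n) (P₆-free : Free P6 G) (diamond-free : Free Diamond G) where

  open Structure G P₆-free diamond-free
  open Clique G

  -- The number `w` is fixed for the whole induction and only bounds the cliques of `U`, so proper
  -- subsets are measured against the same `w + 3`.
  module Critical {U : Pred V 0ℓ} (U? : Decidable U) (w : ℕ)
    (clique-bound : ∀ L → All U L → AllPairs _~_ L → length L ≤ w)
    (smaller : ∀ {P} → Decidable P → (∀ v → P v → U v) → ∀ x → U x → ¬ P x → Col P (w + 3))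
    (uncolourable : ¬ Col U (w + 3)) where

    -- The lower bound `w + 3` for degrees, phrased through lists: if a shorter list contained all
    -- neighbours of `v`, then `v` could be coloured last.
    degree : ∀ v → U v → ∀ L → length L < w + 3 → ∃ λ u → U u × u ~ v × u ∉ L
    degree v Uv L short with any? (λ u → U? u ×-dec (u ~? v) ×-dec ¬? (_∈?_ _≟_ u L))
    ... | yes found = found
    ... | no none = ⊥-elim (uncolourable (extend v L short
      (λ u Uu e → decidable-stable (_∈?_ _≟_ u L) λ u∉ → none (u , Uu , e , u∉))
      (smaller (∖? U? v) (λ _ → proj₁) v Uv (λ q → proj₂ q refl))))

    -- For adjacent `u` and `v`, the degree bound is applied to their common neighbours together
    -- with `L`. If they are not adjacent and every neighbour of `u` sees `v`, then `u` can take the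
    -- colour of `v`.
    private-nbr : ∀ u v → U u → U v → u ≢ v → ∀ L → length L < quota (adj G u v) →
      ∃ λ x → U x × x ~ u × x ≁ v × x ∉ L
    private-nbr u v Uu Uv u≢v L short with adj G u v in eq
    private-nbr u v Uu Uv u≢v L short | true =
      let x , Ux , x~u , x∉ = degree u Uu (members common? ++ L) bound
      in x , Ux , x~u , ¬~⇒≁ (λ x~v → x∉ (∈-++⁺ˡ (∈-members⁺ common? (Ux , x~u , x~v)))) , x∉ ∘ ∈-++⁺ʳ (members common?)
      where
      common? : Decidable (λ x → U x × x ~ u × x ~ v)
      common? x = U? x ×-dec (x ~? u) ×-dec (x ~? v)
      common : ∀ {x} → x ∈ members common? → U x × x ~ u × x ~ v
      common = ∈-members⁻ common?
      bound : length (members common? ++ L) < w + 3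
      bound rewrite length-++ (members common?) {L} = quota-bound
        (clique-bound (u ∷ v ∷ members common?) (Uu ∷ Uv ∷ All.tabulate (proj₁ ∘ common))
          ((eq ∷ All.tabulate (~-sym ∘ proj₁ ∘ proj₂ ∘ common)) ∷ All.tabulate (~-sym ∘ proj₂ ∘ proj₂ ∘ common) ∷
            members-clique common? λ (_ , a~u , a~v) (_ , b~u , b~v) → common-nbrs eq (~-sym a~u) (~-sym a~v) (~-sym b~u) (~-sym b~v)))
        short
    private-nbr u v Uu Uv u≢v (_ ∷ _) (s≤s ()) | false
    private-nbr u v Uu Uv u≢v [] short | false with any? (λ x → U? x ×-dec (x ~? u) ×-dec (x ≁? v))
    ... | yes (x , Ux , x~u , x≁v) = x , Ux , x~u , x≁v , λ ()
    ... | no none = ⊥-elim (uncolourable (recolour u c (proj₁ c v) λ x Ux x~u → proj₂ c (Ux , ~⇒≢ x~u) (Uv , ≢-sym u≢v)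
        (decidable-stable (x ~? v) λ x≁v → none (x , Ux , x~u , ¬~⇒≁ x≁v))))
      where
      c = smaller (∖? U? u) (λ _ → proj₁) u Uu (λ q → proj₂ q refl)

    -- The set `S` may be empty; the lemma then says that `U` is connected.
    no-clique-cutset : ∀ {K S} → Decidable K → Decidable S → (∀ v → K v → U v) →
      (∀ {u v} → S u → S v → u ≢ v → u ~ v) → (∀ {u v} → K u → U v → ¬ K v → u ~ v → S v) →
      ∀ x → K x → ∀ y → U y → ¬ K y → ¬ S y → ⊥
    no-clique-cutset K? S? K⊆U clique boundary x Kx y Uy ¬Ky ¬Sy = uncolourable (col-cutset U? K? S? K⊆U clique boundary
      (smaller (λ v → U? v ×-dec (K? v ⊎-dec S? v)) (λ _ → proj₁) y Uy λ { (_ , inj₁ Ky) → ¬Ky Ky ; (_ , inj₂ Sy) → ¬Sy Sy })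
      (smaller (λ v → U? v ×-dec ¬? (K? v)) (λ _ → proj₁) x (K⊆U x Kx) λ q → proj₂ q Kx))

    module Engine (k₄ : Bool) (no-K₄ : k₄ ≡ true → ∀ a b c d → U a → U b → U c → U d →
      a ~ b → a ~ c → a ~ d → b ~ c → b ~ d → c ~ d → ⊥) where
      open Soundness (adj G) (Graph.sym G) (irrefl G) U no-P₆ no-diamond k₄ no-K₄ private-nbr public

    -- The neighbourhood of a maximal clique.

    module AroundClique (3≤w : 3 ≤ w) {T : Pred V 0ℓ} (T? : Decidable T) (T⊆U : ∀ {v} → T v → U v)
      (T-clique : ∀ {s t} → T s → T t → s ≢ t → s ~ t)
      -- Maximality in its diamond-free form, at most one neighbour in `T` from outside; `another`
      -- expresses that `T` has at least three vertices.
      (T-maximal : ∀ {v s t} → U v → ¬ T v → T s → T t → s ≢ t → v ~ s → v ~ t → ⊥)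
      (another : ∀ a b → ∃ λ c → T c × c ≢ a × c ≢ b) where

      A : V → Pred V 0ℓ
      A t v = U v × ¬ T v × v ~ t

      A? : ∀ t → Decidable (A t)
      A? t v = U? v ×-dec ¬? (T? v) ×-dec (v ~? t)

      Outer Z : Pred V 0ℓ
      Outer v = ∃ λ t → T t × A t v
      Z v = U v × (∀ t → T t → v ≁ t)

      Outer? : Decidable Outer
      Outer? v = any? λ t → T? t ×-dec A? t v

      Z? : Decidable Z
      Z? v = U? v ×-dec all? λ t → T? t →-dec (v ≁? t)

      Z⇒¬T : ∀ {v} → Z v → ¬ T v
      Z⇒¬T {v} (_ , v≁) Tv = let c , Tc , c≢v , _ = another v v in clash (T-clique Tv Tc (≢-sym c≢v)) (v≁ c Tc)

      A-far : ∀ {s t v} → T t → A t v → T s → s ≢ t → v ≁ s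
      A-far Tt (Uv , ¬Tv , v~t) Ts s≢t = ¬~⇒≁ λ v~s → T-maximal Uv ¬Tv Ts Tt s≢t v~s v~t

      classify : ∀ {v} → U v → ¬ T v → ¬ Z v → Outer v
      classify {v} Uv ¬Tv ¬Zv with any? (λ t → T? t ×-dec (v ~? t))
      ... | yes (t , Tt , v~t) = t , Tt , Uv , ¬Tv , v~t
      ... | no none = ⊥-elim (¬Zv (Uv , λ t Tt → ¬~⇒≁ λ v~t → none (t , Tt , v~t)))

      -- A second vertex `b` of `T` prolongs the path to `b a x p q r`.
      no-P₄-into-Z : ∀ {a x} → T a → A a x → ∀ {p q r} → Z p → Z q → Z r →
        x ~ p → p ~ q → q ~ r → x ≁ q → x ≁ r → p ≁ r → ⊥
      no-P₄-into-Z {a} {x} Ta Ax@(_ , _ , x~a) {p} {q} {r} Zp Zq Zr x~p p~q q~r x≁q x≁r p≁r =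
        let b , Tb , b≢a , _ = another a a in
        no-P₆ b a x p q r (T-clique Tb Ta b≢a) (~-sym x~a) x~p p~q q~r
          (≁-sym (A-far Ta Ax Tb b≢a)) (≁-sym (proj₂ Zp b Tb)) (≁-sym (proj₂ Zq b Tb)) (≁-sym (proj₂ Zr b Tb))
          (≁-sym (proj₂ Zp a Ta)) (≁-sym (proj₂ Zq a Ta)) (≁-sym (proj₂ Zr a Ta)) x≁q x≁r p≁r

      -- Since `U` is connected, some vertex `x` outside `C` sees `C`. It is not in `T`, which has
      -- no neighbours in `Z`, and not in `Z`, by closedness.
      attached : ∀ (C : Component Z) → ∃₂ λ a x → ∃ λ d → T a × A a x × Component.K C d × x ~ d
      attached C with any? (λ x → U? x ×-dec ¬? (Component.K? C x) ×-dec any? (λ d → Component.K? C d ×-dec (x ~? d)))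
      ... | no none = ⊥-elim (no-clique-cutset {S = λ _ → ⊥} K? (λ _ → no id) (λ v → proj₁ ∘ K⊆ v) (λ ())
            (λ {u} {v} Ku Uv ¬Kv u~v → none (v , Uv , ¬Kv , u , Ku , ~-sym u~v)) root K-root
            (proj₁ c) (T⊆U (proj₁ (proj₂ c))) (λ Kc → Z⇒¬T (K⊆ _ Kc) (proj₁ (proj₂ c))) id)
        where
        open Component C
        c = another root root
      ... | yes (x , Ux , ¬Kx , d , Kd , x~d) =
        let open Component C
            a , Ta , Ax = classify Ux (λ Tx → clash (~-sym x~d) (proj₂ (K⊆ d Kd) x Tx)) (λ Zx → ¬Kx (closed Kd Zx (~-sym x~d)))
        in a , x , d , Ta , Ax , Kd , x~d

      T-col : Col T w
      T-col = greedy T? (λ _ → inject≤ zero 3≤w) λ v Tv →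
        let others? = ∖? T? v in
        members others? ,
        clique-bound (v ∷ members others?) (T⊆U Tv ∷ All.tabulate (T⊆U ∘ proj₁ ∘ ∈-members⁻ others?))
          (All.tabulate (λ u∈ → let Tu , u≢v = ∈-members⁻ others? u∈ in T-clique Tv Tu (≢-sym u≢v)) ∷
           members-clique others? λ (Ta , _) (Tb , _) → T-clique Ta Tb) ,
        λ u Tu u~v → ∈-members⁺ others? (Tu , ~⇒≢ u~v)

      record Config (a b x x′ y : V) : Set where
        field
          Ta : T a
          Tb : T b
          b≢a : b ≢ a
          Ax : A a x
          Ax′ : A a x′
          x~x′ : x ~ x′
          Ay : A b y
          x~y : x ~ y

        -- Otherwise `a` and `y` would be common neighbours of the edge `x x′` and hence adjacent.
        y≁x′ : y ≁ x′
        y≁x′ = ¬~⇒≁ λ y~x′ → clash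
          (common-nbrs x~x′ (proj₂ (proj₂ Ax)) (proj₂ (proj₂ Ax′)) x~y (~-sym y~x′) (λ { refl → proj₁ (proj₂ Ay) Ta }))
          (≁-sym (A-far Tb Ay Ta (≢-sym b≢a)))

      -- Suppose that no edge inside `A a` has an end with a neighbour in another `A b`. Among the
      -- vertices of `Z` and `A a` without neighbours in those sets, the component `K` of `x` then
      -- has `a` as its only outside neighbour, so `a` is a cut vertex.
      config : ∀ {a x x′} → T a → A a x → A a x′ → x ~ x′ → ∃₂ λ b x₁ → ∃₂ λ x₁′ y → Config a b x₁ x₁′ y
      config {a} {x} {x′} Ta Ax Ax′ x~x′
        with any? (λ x → any? λ x′ → any? λ b → any? λ y →
          A? a x ×-dec A? a x′ ×-dec (x ~? x′) ×-dec T? b ×-dec ¬? (b ≟ a) ×-dec A? b y ×-dec (x ~? y))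
      ... | yes (x₁ , x₁′ , b , y , Ax₁ , Ax₁′ , e , Tb , b≢a , Ay , x~y) = b , x₁ , x₁′ , y ,
        record { Ta = Ta ; Tb = Tb ; b≢a = b≢a ; Ax = Ax₁ ; Ax′ = Ax₁′ ; x~x′ = e ; Ay = Ay ; x~y = x~y }
      ... | no none = ⊥-elim (no-clique-cutset {S = _≡ a} K? (_≟ a) (λ v Kv → inU (proj₁ (K⊆ v Kv)))
          (λ { refl refl a≢a → ⊥-elim (a≢a refl) }) boundary x Kx (proj₁ c) (T⊆U Tc)
          (λ Kc → outside (proj₁ (K⊆ _ Kc)) Tc) (proj₁ (proj₂ (proj₂ c))))
        where
        Side : Pred V 0ℓ
        Side v = Z v ⊎ A a v
        P : Pred V 0ℓ
        P v = Side v × (∀ b → T b → b ≢ a → ∀ y → A b y → v ≁ y)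
        P? : Decidable P
        P? v = (Z? v ⊎-dec A? a v) ×-dec all? λ b → T? b →-dec ¬? (b ≟ a) →-dec all? λ y → A? b y →-dec (v ≁? y)
        inU : ∀ {v} → Side v → U v
        inU (inj₁ Zv) = proj₁ Zv
        inU (inj₂ Av) = proj₁ Av
        outside : ∀ {v} → Side v → ¬ T v
        outside (inj₁ Zv) = Z⇒¬T Zv
        outside (inj₂ Av) = proj₁ (proj₂ Av)
        side-far : ∀ {v b} → Side v → T b → b ≢ a → v ≁ b
        side-far (inj₁ Zv) Tb _ = proj₂ Zv _ Tb
        side-far (inj₂ Av) Tb b≢a = A-far Ta Av Tb b≢a
        quiet : ∀ {x x′} → A a x → A a x′ → x ~ x′ → P x
        quiet Ax Ax′ e = inj₂ Ax , λ b Tb b≢a y Ay → ¬~⇒≁ λ x~y → none (_ , _ , b , y , Ax , Ax′ , e , Tb , b≢a , Ay , x~y)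
        C = proj₁ (component P? x (quiet Ax Ax′ x~x′))
        Kx = proj₂ (component P? x (quiet Ax Ax′ x~x′))
        open Component C
        Kx′ : K x′
        Kx′ = closed Kx (quiet Ax′ Ax (~-sym x~x′)) x~x′
        c = another a a
        Tc = proj₁ (proj₂ c)
        -- A vertex v outside K seeing y ∈ A_b cannot see both x and x′, so connectivity of K yields
        -- an induced path p₂ p₁ v y b d with d ∈ T.
        escape : ∀ {u v b y} → K u → Side v → u ~ v → T b → b ≢ a → A b y → v ~ y → ⊥
        escape {u} {v} {b} {y} Ku Sv u~v Tb b≢a Ay v~y =
          let z , Kz , ¬z~v = unseen Sv
              p₁ , p₂ , Kp₁ , Kp₂ , p₁~p₂ , p₁~v , ¬p₂~v = crossing (_~? v) Ku u~v Kz ¬z~v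
              S₁ , P₁ = K⊆ p₁ Kp₁
              S₂ , P₂ = K⊆ p₂ Kp₂
              d , Td , d≢a , d≢b = another a b
          in no-P₆ p₂ p₁ v y b d (~-sym p₁~p₂) p₁~v v~y (proj₂ (proj₂ Ay)) (T-clique Tb Td (≢-sym d≢b))
            (¬~⇒≁ ¬p₂~v) (P₂ b Tb b≢a y Ay) (side-far S₂ Tb b≢a) (side-far S₂ Td d≢a)
            (P₁ b Tb b≢a y Ay) (side-far S₁ Tb b≢a) (side-far S₁ Td d≢a)
            (side-far Sv Tb b≢a) (side-far Sv Td d≢a) (A-far Tb Ay Td d≢b)
          where
          unseen : Side v → ∃ λ z → K z × ¬ z ~ v
          unseen _ with x ~? v | x′ ~? v
          unseen _ | no ¬e | _ = x , Kx , ¬e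
          unseen _ | yes _ | no ¬e = x′ , Kx′ , ¬e
          unseen (inj₂ Av) | yes x~v | yes x′~v = ⊥-elim (none (v , x , b , y , Av , Ax , ~-sym x~v , Tb , b≢a , Ay , v~y))
          unseen (inj₁ Zv) | yes x~v | yes x′~v = ⊥-elim (clash
            (common-nbrs x~x′ (proj₂ (proj₂ Ax)) (proj₂ (proj₂ Ax′)) x~v x′~v (λ { refl → Z⇒¬T Zv Ta })) (≁-sym (proj₂ Zv a Ta)))
        stuck : ∀ {u v} → K u → Side v → ¬ K v → u ~ v → ⊥
        stuck {u} {v} Ku Sv ¬Kv u~v with any? (λ b → any? λ y → T? b ×-dec ¬? (b ≟ a) ×-dec A? b y ×-dec (v ~? y))
        ... | yes (b , y , Tb , b≢a , Ay , v~y) = escape Ku Sv u~v Tb b≢a Ay v~y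
        ... | no quiet-v = ¬Kv (closed Ku
          (Sv , λ b Tb b≢a y Ay → ¬~⇒≁ λ v~y → quiet-v (b , y , Tb , b≢a , Ay , v~y)) u~v)
        boundary : ∀ {u v} → K u → U v → ¬ K v → u ~ v → v ≡ a
        boundary {u} {v} Ku Uv ¬Kv u~v with v ≟ a
        ... | yes v≡a = v≡a
        ... | no v≢a with T? v
        ... | yes Tv = ⊥-elim (clash u~v (side-far (proj₁ (K⊆ u Ku)) Tv v≢a))
        ... | no ¬Tv with Z? v
        ... | yes Zv = ⊥-elim (stuck Ku (inj₁ Zv) ¬Kv u~v)
        ... | no ¬Zv with classify Uv ¬Tv ¬Zv
        ... | t , Tt , Av with t ≟ a
        ... | yes refl = ⊥-elim (stuck Ku (inj₂ Av) ¬Kv u~v)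
        ... | no t≢a = ⊥-elim (clash u~v (proj₂ (K⊆ u Ku) t Tt t≢a v Av))

      module Cases
        (singly-attached : ∀ {a s c₁ c₂ c₃} → T a → A a s → Z c₁ → Z c₂ → Z c₃ → c₁ ~ c₂ → c₁ ~ c₃ → c₂ ~ c₃ →
          s ~ c₁ → s ≁ c₂ → s ≁ c₃ → ⊥) where

        -- Every outer vertex that sees the component of the triangle sees both `c₁` and `c₂`, as
        -- `complete` shows. These vertices therefore form a clique, and it separates the component
        -- from `T`.
        Z-triangle-free : TriangleFree Z
        Z-triangle-free {c₁} {c₂} {c₃} Z₁ Z₂ Z₃ e₁₂ e₁₃ e₂₃ =
          no-clique-cutset {S = Rim} K? Rim? (λ v → proj₁ ∘ K⊆ v) Rim-clique boundary c₁ K₁ (proj₁ t) (T⊆U Tt)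
            (λ Kt → Z⇒¬T (K⊆ _ Kt) Tt) (λ { ((_ , _ , _ , ¬Tt , _) , _) → ¬Tt Tt })
          where
          C = proj₁ (component Z? c₁ Z₁)
          K₁ = proj₂ (component Z? c₁ Z₁)
          open Component C
          K₂ = closed K₁ Z₂ e₁₂
          t = another c₁ c₁
          Tt = proj₁ (proj₂ t)
          Rim : Pred V 0ℓ
          Rim x = Outer x × ∃ λ d → K d × x ~ d
          Rim? : Decidable Rim
          Rim? x = Outer? x ×-dec any? λ d → K? d ×-dec (x ~? d)
          complete : ∀ {x} → Rim x → x ~ c₁ × x ~ c₂
          complete {x} ((a , Ta , Ax) , d , Kd , x~d) with x ~? c₁ | x ~? c₂ | x ~? c₃
          ... | yes e₁ | yes e₂ | _ = e₁ , e₂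
          ... | yes e₁ | no ¬e₂ | no ¬e₃ = ⊥-elim (singly-attached Ta Ax Z₁ Z₂ Z₃ e₁₂ e₁₃ e₂₃ e₁ (¬~⇒≁ ¬e₂) (¬~⇒≁ ¬e₃))
          ... | no ¬e₁ | yes e₂ | no ¬e₃ = ⊥-elim (singly-attached Ta Ax Z₂ Z₁ Z₃ (~-sym e₁₂) e₂₃ e₁₃ e₂ (¬~⇒≁ ¬e₁) (¬~⇒≁ ¬e₃))
          ... | no ¬e₁ | no ¬e₂ | yes e₃ = ⊥-elim (singly-attached Ta Ax Z₃ Z₁ Z₂ (~-sym e₁₃) (~-sym e₂₃) e₁₂ e₃ (¬~⇒≁ ¬e₁) (¬~⇒≁ ¬e₂))
          ... | yes e₁ | no ¬e₂ | yes e₃ = ⊥-elim (¬e₂ (common-nbrs e₁₃ (~-sym e₁) (~-sym e₃) e₁₂ (~-sym e₂₃)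
            (λ { refl → clash (proj₂ (proj₂ Ax)) (proj₂ Z₂ a Ta) })))
          ... | no ¬e₁ | yes e₂ | yes e₃ = ⊥-elim (¬e₁ (common-nbrs e₂₃ (~-sym e₂) (~-sym e₃) (~-sym e₁₂) (~-sym e₁₃)
            (λ { refl → clash (proj₂ (proj₂ Ax)) (proj₂ Z₁ a Ta) })))
          -- If `x` sees none of the three, a common neighbour `d′` of `x` and `c₁` yields either
          -- the triangle `d′ c₁ c₂`, met by `x` in `d′` only, or the induced path `x d′ c₁ c₂`.
          ... | no ¬e₁ | no ¬e₂ | no ¬e₃ with Attached.dominated C x
                (λ Ka Kb Kc → no-P₄-into-Z Ta Ax (K⊆ _ Ka) (K⊆ _ Kb) (K⊆ _ Kc)) Kd x~d K₁ (¬~⇒≁ ¬e₁)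
          ... | d′ , Kd′ , x~d′ , d′~c₁ with d′ ~? c₂
          ... | yes d′~c₂ = ⊥-elim (singly-attached Ta Ax (K⊆ _ Kd′) Z₁ Z₂ d′~c₁ d′~c₂ e₁₂ x~d′ (¬~⇒≁ ¬e₁) (¬~⇒≁ ¬e₂))
          ... | no ¬d′~c₂ = ⊥-elim (no-P₄-into-Z Ta Ax (K⊆ _ Kd′) Z₁ Z₂ x~d′ d′~c₁ e₁₂ (¬~⇒≁ ¬e₁) (¬~⇒≁ ¬e₂) (¬~⇒≁ ¬d′~c₂))
          Rim-clique : ∀ {u v} → Rim u → Rim v → u ≢ v → u ~ v
          Rim-clique Xu Xv = let u₁ , u₂ = complete Xu ; v₁ , v₂ = complete Xv in
            common-nbrs e₁₂ (~-sym u₁) (~-sym u₂) (~-sym v₁) (~-sym v₂)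
          boundary : ∀ {u v} → K u → U v → ¬ K v → u ~ v → Rim v
          boundary {u} {v} Ku Uv ¬Kv u~v =
            classify Uv (λ Tv → clash u~v (proj₂ (K⊆ u Ku) v Tv)) (λ Zv → ¬Kv (closed Ku Zv u~v)) , u , Ku , ~-sym u~v

        Z-col : Col Z 3
        Z-col = col-components Z? (const zero) λ C →
          let a , x , d , Ta , Ax , Kd , x~d = attached C
              open Component C in
          Attached.col-3 C x (λ Ka Kb Kc → no-P₄-into-Z Ta Ax (K⊆ _ Ka) (K⊆ _ Kb) (K⊆ _ Kc)) Kd x~d
            (λ Ka Kb Kc → Z-triangle-free (K⊆ _ Ka) (K⊆ _ Kb) (K⊆ _ Kc))

        anchor : V → V
        anchor v with any? (λ t → T? t ×-dec (v ~? t))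
        ... | yes (t , _) = t
        ... | no _ = v

        anchor-spec : ∀ {t v} → T t → A t v → anchor v ≡ t
        anchor-spec {t} {v} Tt Av with any? (λ t → T? t ×-dec (v ~? t))
        ... | no none = ⊥-elim (none (t , Tt , proj₂ (proj₂ Av)))
        ... | yes (s , Ts , v~s) = decidable-stable (s ≟ t) λ s≢t → clash v~s (A-far Tt Av Ts s≢t)

        -- `A t` takes the rotated colour of `t`. It differs from the colour of `t`, the only vertex
        -- of `T` seen from `A t`, and different `t` still give different colours. So `w` colours
        -- suffice off `Z`.
        not-all-independent : ¬ (∀ {a u v} → T a → A a u → A a v → u ~ v → ⊥)
        not-all-independent independent = uncolourable (col-+ (λ v → U? v ×-dec ¬? (Z? v))
            (λ v Uv ¬near → decidable-stable (Z? v) λ ¬Zv → ¬near (Uv , ¬Zv)) (shifted 3≤w T-col) Z-col)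
          where
          shifted : ∀ {k} → 3 ≤ k → Col T k → Col (λ v → U v × ¬ Z v) k
          shifted (s≤s (s≤s _)) c@(colour , ok) = glue T? (λ v (Uv , ¬Zv) ¬Tv → classify Uv ¬Tv ¬Zv) c
            (rotate ∘ colour ∘ anchor , outer-ok)
            λ {u} {v} Tu (Uv , ¬Zv) ¬Tv u~v eq → rotate-moves (colour u)
              (trans eq (cong (rotate ∘ colour) (anchor-spec Tu (Uv , ¬Tv , ~-sym u~v))))
            where
            outer-ok : Proper Outer (rotate ∘ colour ∘ anchor)
            outer-ok (s , Ts , Au) (t , Tt , Av) u~v eq with s ≟ t
            ... | yes refl = independent Ts Au Av u~v
            ... | no s≢t = ok Ts Tt (T-clique Ts Tt s≢t)
              (trans (cong colour (sym (anchor-spec Ts Au))) (trans (rotate-injective eq) (cong colour (anchor-spec Tt Av))))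

        module Configured {a b x x′ y} (cfg : Config a b x x′ y)
          (dominating : ∀ {m v} → T m → m ≢ a → A m v → v ≁ x → v ≁ x′ → ⊥)
          (no-triangle : ∀ {m l u v} → T m → T l → m ≢ a → l ≢ a → l ≢ m → A m u → A l v → u ~ x → v ~ x → u ~ v → ⊥)
          (no-triangle′ : ∀ {m l u v} → T m → T l → m ≢ a → l ≢ a → l ≢ m → A m u → A l v → u ~ x′ → v ~ x′ → u ~ v → ⊥)
          (no-third : ∀ {u} → A a u → u ~ x → u ~ x′ → ⊥)
          (separated : ∀ {m u v} → T m → m ≢ a → A a u → u ≁ x → u ≁ x′ → u ≁ y → A m v → v ~ x → v ~ u → ⊥)
          (no-edge : ∀ {u v} → A a u → A a v → u ≁ x → u ≁ x′ → u ≁ y → v ≁ x → v ≁ x′ → v ≁ y → u ~ v → ⊥)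
          where

          open Config cfg

          private
            ~a : ∀ {v} → A a v → a ~ v
            ~a (_ , _ , v~a) = ~-sym v~a

          -- A neighbour `u ≢ x′` of `x` in `A a` also sees `x′`, since `u` and `x′` are common
          -- neighbours of the edge `a x`; this is excluded by `no-third`. Likewise with `x` and
          -- `x′` exchanged, where `u ≢ x` because `x` sees `y`.
          away : ∀ {u} → A a u → u ≁ y → u ≡ x′ ⊎ (u ≁ x × u ≁ x′)
          away {u} Au u≁y with u ≟ x′ | u ~? x | u ~? x′
          ... | yes u≡x′ | _ | _ = inj₁ u≡x′
          ... | no _ | yes u~x | yes u~x′ = ⊥-elim (no-third Au u~x u~x′)
          ... | no u≢x′ | yes u~x | no ¬u~x′ = ⊥-elim (¬u~x′ (common-nbrs (~a Ax) (~a Au) (~-sym u~x) (~a Ax′) x~x′ u≢x′))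
          ... | no _ | no ¬u~x | yes u~x′ = ⊥-elim (¬u~x
            (common-nbrs (~a Ax′) (~a Au) (~-sym u~x′) (~a Ax) (~-sym x~x′) (λ { refl → clash x~y u≁y })))
          ... | no _ | no ¬u~x | no ¬u~x′ = inj₂ (¬~⇒≁ ¬u~x , ¬~⇒≁ ¬u~x′)

          -- Both `m` and `z` are common neighbours of the edge `u v`, so they would be adjacent.
          same-anchor : ∀ {m u v z} → T m → A m u → A m v → u ~ v → U z → ¬ T z → z ≁ m → u ~ z → v ~ z → ⊥
          same-anchor Tm (_ , _ , u~m) (_ , _ , v~m) u~v Uz ¬Tz z≁m u~z v~z =
            clash (common-nbrs u~v u~z v~z u~m v~m (λ { refl → ¬Tz Tm })) z≁m

          -- The vertex `x` itself falls into `Class₃`, `x′` and `y` into `Class₁`. All of `Class₂`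
          -- sees `x′`, by `dominating`.
          Class₁ Class₂ Class₃ : Pred V 0ℓ
          Class₃ v = A a v × v ~ y
          Class₂ v = Outer v × v ≁ a × v ≁ x
          Class₁ v = (A a v × v ≁ y) ⊎ (Outer v × v ≁ a × v ~ x)

          independent₃ : ∀ {u v} → Class₃ u → Class₃ v → u ~ v → ⊥
          independent₃ (Au , u~y) (Av , v~y) u~v =
            same-anchor Ta Au Av u~v (proj₁ Ay) (proj₁ (proj₂ Ay)) (A-far Tb Ay Ta (≢-sym b≢a)) u~y v~y

          anchored-elsewhere : ∀ {t v} → A t v → v ≁ a → t ≢ a
          anchored-elsewhere (_ , _ , v~a) v≁a refl = clash v~a v≁a

          independent₂ : ∀ {u v} → Class₂ u → Class₂ v → u ~ v → ⊥
          independent₂ {u} {v} ((s , Ts , Au) , u≁a , u≁x) ((t , Tt , Av) , v≁a , v≁x) u~v with u ~? x′ | v ~? x′ | t ≟ s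
          ... | no ¬u~x′ | _ | _ = dominating Ts (anchored-elsewhere Au u≁a) Au u≁x (¬~⇒≁ ¬u~x′)
          ... | yes _ | no ¬v~x′ | _ = dominating Tt (anchored-elsewhere Av v≁a) Av v≁x (¬~⇒≁ ¬v~x′)
          ... | yes u~x′ | yes v~x′ | yes refl = same-anchor Ts Au Av u~v (proj₁ Ax′) (proj₁ (proj₂ Ax′))
            (A-far Ta Ax′ Ts (anchored-elsewhere Au u≁a)) u~x′ v~x′
          ... | yes u~x′ | yes v~x′ | no t≢s =
            no-triangle′ Ts Tt (anchored-elsewhere Au u≁a) (anchored-elsewhere Av v≁a) t≢s Au Av u~x′ v~x′ u~v

          mixed : ∀ {u v} → A a u → u ≁ y → Outer v → v ≁ a → v ~ x → u ~ v → ⊥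
          mixed Au u≁y (t , Tt , Av) v≁a v~x u~v with away Au u≁y
          ... | inj₁ refl = clash (common-nbrs x~x′ (~-sym v~x) u~v (~-sym (~a Ax)) (~-sym (~a Ax′)) (λ { refl → proj₁ (proj₂ Av) Ta })) v≁a
          ... | inj₂ (u≁x , u≁x′) = separated Tt (anchored-elsewhere Av v≁a) Au u≁x u≁x′ u≁y Av v~x (~-sym u~v)

          independent₁ : ∀ {u v} → Class₁ u → Class₁ v → u ~ v → ⊥
          independent₁ (inj₁ (Au , u≁y)) (inj₁ (Av , v≁y)) u~v with away Au u≁y | away Av v≁y
          ... | inj₁ refl | inj₁ refl = ~⇒≢ u~v refl
          ... | inj₁ refl | inj₂ (_ , v≁x′) = clash (~-sym u~v) v≁x′
          ... | inj₂ (_ , u≁x′) | inj₁ refl = clash u~v u≁x′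
          ... | inj₂ (u≁x , u≁x′) | inj₂ (v≁x , v≁x′) = no-edge Au Av u≁x u≁x′ u≁y v≁x v≁x′ v≁y u~v
          independent₁ (inj₁ (Au , u≁y)) (inj₂ (Ov , v≁a , v~x)) u~v = mixed Au u≁y Ov v≁a v~x u~v
          independent₁ (inj₂ (Ou , u≁a , u~x)) (inj₁ (Av , v≁y)) u~v = mixed Av v≁y Ou u≁a u~x (~-sym u~v)
          independent₁ (inj₂ ((s , Ts , Au) , u≁a , u~x)) (inj₂ ((t , Tt , Av) , v≁a , v~x)) u~v with t ≟ s
          ... | yes refl = same-anchor Ts Au Av u~v (proj₁ Ax) (proj₁ (proj₂ Ax)) (A-far Ta Ax Ts (anchored-elsewhere Au u≁a)) u~x v~x
          ... | no t≢s = no-triangle Ts Tt (anchored-elsewhere Au u≁a) (anchored-elsewhere Av v≁a) t≢s Au Av u~x v~x u~v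

          Outer-col : Col Outer 3
          Outer-col = col-+ (λ v → A? a v ×-dec (v ~? y)) cover (col-independent independent₃)
            (col-+ (λ v → Outer? v ×-dec (v ≁? a) ×-dec (v ≁? x)) cover′ (col-independent independent₂) (col-independent independent₁))
            where
            Rest : Pred V 0ℓ
            Rest v = Outer v × ¬ Class₃ v
            cover : ∀ v → Outer v → ¬ Class₃ v → Rest v
            cover v Ov ¬₃ = Ov , ¬₃
            cover′ : ∀ v → Rest v → ¬ Class₂ v → Class₁ v
            cover′ v (Ov@(_ , _ , Uv , ¬Tv , _) , ¬₃) ¬₂ with v ~? a | v ~? x
            ... | yes v~a | _ = inj₁ ((Uv , ¬Tv , v~a) , ¬~⇒≁ λ v~y → ¬₃ ((Uv , ¬Tv , v~a) , v~y))
            ... | no ¬v~a | yes v~x = inj₂ (Ov , ¬~⇒≁ ¬v~a , v~x)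
            ... | no ¬v~a | no ¬v~x = ⊥-elim (¬₂ (Ov , ¬~⇒≁ ¬v~a , ¬~⇒≁ ¬v~x))

          contradiction : ⊥
          contradiction = uncolourable (col-+ (λ v → T? v ⊎-dec Z? v)
            (λ v Uv ¬TZ → classify Uv (¬TZ ∘ inj₁) (¬TZ ∘ inj₂))
            (col-∪ T? (λ { _ (inj₁ Tv) ¬Tv → ⊥-elim (¬Tv Tv) ; _ (inj₂ Zv) _ → Zv })
              (λ { Tu (inj₁ Tv) ¬Tv _ → ¬Tv Tv ; Tu (inj₂ Zv) _ u~v → clash (~-sym u~v) (proj₂ Zv _ Tu) })
              T-col (col-≤ 3≤w Z-col))
            Outer-col)

    -- The maximal clique through an edge.

    module EdgeClique {a₀ b₀ : V} (Ua₀ : U a₀) (Ub₀ : U b₀) (a₀~b₀ : a₀ ~ b₀) where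

      -- By `common-nbrs` an edge and its common neighbours already form a maximal clique, so it can
      -- be written down explicitly.
      T : Pred V 0ℓ
      T v = U v × (v ≡ a₀ ⊎ v ≡ b₀ ⊎ (v ~ a₀ × v ~ b₀))

      T? : Decidable T
      T? v = U? v ×-dec ((v ≟ a₀) ⊎-dec (v ≟ b₀) ⊎-dec ((v ~? a₀) ×-dec (v ~? b₀)))

      T-clique : ∀ {s t} → T s → T t → s ≢ t → s ~ t
      T-clique (_ , inj₁ refl) (_ , inj₁ refl) s≢t = ⊥-elim (s≢t refl)
      T-clique (_ , inj₁ refl) (_ , inj₂ (inj₁ refl)) _ = a₀~b₀
      T-clique (_ , inj₁ refl) (_ , inj₂ (inj₂ (t~a , _))) _ = ~-sym t~a
      T-clique (_ , inj₂ (inj₁ refl)) (_ , inj₁ refl) _ = ~-sym a₀~b₀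
      T-clique (_ , inj₂ (inj₁ refl)) (_ , inj₂ (inj₁ refl)) s≢t = ⊥-elim (s≢t refl)
      T-clique (_ , inj₂ (inj₁ refl)) (_ , inj₂ (inj₂ (_ , t~b))) _ = ~-sym t~b
      T-clique (_ , inj₂ (inj₂ (s~a , _))) (_ , inj₁ refl) _ = s~a
      T-clique (_ , inj₂ (inj₂ (_ , s~b))) (_ , inj₂ (inj₁ refl)) _ = s~b
      T-clique (_ , inj₂ (inj₂ (s~a , s~b))) (_ , inj₂ (inj₂ (t~a , t~b))) =
        common-nbrs a₀~b₀ (~-sym s~a) (~-sym s~b) (~-sym t~a) (~-sym t~b)

      -- Any further `r` in `T` is, like `v`, a common neighbour of the edge `s t`. So `v` sees all
      -- of `T`, in particular `a₀` and `b₀`, and would belong to `T`.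
      T-maximal : ∀ {v s t} → U v → ¬ T v → T s → T t → s ≢ t → v ~ s → v ~ t → ⊥
      T-maximal {v} {s} {t} Uv ¬Tv Ts Tt s≢t v~s v~t =
        ¬Tv (Uv , inj₂ (inj₂ (sees (Ua₀ , inj₁ refl) , sees (Ub₀ , inj₂ (inj₁ refl)))))
        where
        sees : ∀ {r} → T r → v ~ r
        sees {r} Tr with r ≟ s | r ≟ t
        ... | yes refl | _ = v~s
        ... | no _ | yes refl = v~t
        ... | no r≢s | no r≢t = common-nbrs (T-clique Ts Tt s≢t) (~-sym v~s) (~-sym v~t)
          (T-clique Ts Tr (≢-sym r≢s)) (T-clique Tt Tr (≢-sym r≢t)) (λ { refl → ¬Tv Tr })

      avoid : ∀ M → AllPairs _~_ M → All T M → ∀ L → length L < length M → ∃ λ c → T c × c ∉ L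
      avoid M pairs TM L short =
        let i , i∉ = fresh (List.lookup M)
              (λ {i} {j} eq → decidable-stable (i ≟ j) λ i≢j → ~⇒≢ (pairwise-lookup pairs i j i≢j) eq) L short
        in _ , All.lookup TM (∈-lookup i) , i∉

    -- The case of a clique with four vertices.

    module LargeClique (3≤w : 3 ≤ w) {T : Pred V 0ℓ} (T? : Decidable T) (T⊆U : ∀ {v} → T v → U v)
      (T-clique : ∀ {s t} → T s → T t → s ≢ t → s ~ t)
      (T-maximal : ∀ {v s t} → U v → ¬ T v → T s → T t → s ≢ t → v ~ s → v ~ t → ⊥)
      (four : ∀ L → length L < 4 → ∃ λ c → T c × c ∉ L) where

      another : ∀ a b → ∃ λ c → T c × c ≢ a × c ≢ b
      another a b = let c , Tc , c∉ = four (a ∷ b ∷ []) (s≤s (s≤s (s≤s z≤n))) in c , Tc , c∉ ∘ here , c∉ ∘ there ∘ here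

      open AroundClique 3≤w T? T⊆U T-clique T-maximal another
      open Engine false (λ ())

      module Corner {a b m : V} (Ta : T a) (Tb : T b) (Tm : T m) (b≢a : b ≢ a) (m≢a : m ≢ a) (m≢b : m ≢ b) where
        private
          o = four (a ∷ b ∷ m ∷ []) (s≤s (s≤s (s≤s (s≤s z≤n))))
          n′ = proj₁ o
          Tn = proj₁ (proj₂ o)
          n≢a : n′ ≢ a
          n≢a = proj₂ (proj₂ o) ∘ here
          n≢b : n′ ≢ b
          n≢b = proj₂ (proj₂ o) ∘ there ∘ here
          n≢m : n′ ≢ m
          n≢m = proj₂ (proj₂ o) ∘ there ∘ there ∘ here

        ρ : Vec V 4
        ρ = n′ ∷ m ∷ b ∷ a ∷ []

        exclude : ∀ {ss} → Refuted false (K₄-clique ss) → ¬ Realised ss ρ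
        exclude ref r = refuted ref (a , T⊆U Ta , tt , b , T⊆U Tb , (T-clique Tb Ta b≢a , tt) ,
          m , T⊆U Tm , (T-clique Tm Tb m≢b , T-clique Tm Ta m≢a , tt) ,
          n′ , T⊆U Tn , (T-clique Tn Tm n≢m , T-clique Tn Tb n≢b , T-clique Tn Ta n≢a , tt) , r)

        at-a : ∀ {v} → A a v → Match (O ∷ O ∷ O ∷ I ∷ []) (row v ρ)
        at-a Av = A-far Ta Av Tn n≢a , A-far Ta Av Tm m≢a , A-far Ta Av Tb b≢a , proj₂ (proj₂ Av) , tt

        at-b : ∀ {v} → A b v → Match (O ∷ O ∷ I ∷ O ∷ []) (row v ρ)
        at-b Av = A-far Tb Av Tn n≢b , A-far Tb Av Tm m≢b , proj₂ (proj₂ Av) , A-far Tb Av Ta (≢-sym b≢a) , tt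

        at-m : ∀ {v} → A m v → Match (O ∷ I ∷ O ∷ O ∷ []) (row v ρ)
        at-m Av = A-far Tm Av Tn n≢m , proj₂ (proj₂ Av) , A-far Tm Av Tb (≢-sym m≢b) , A-far Tm Av Ta (≢-sym m≢a) , tt

        at-Z : ∀ {v} → Z v → Match (O ∷ O ∷ O ∷ O ∷ []) (row v ρ)
        at-Z (_ , v≁) = v≁ _ Tn , v≁ _ Tm , v≁ _ Tb , v≁ _ Ta , tt

      singly-attached : ∀ {a s c₁ c₂ c₃} → T a → A a s → Z c₁ → Z c₂ → Z c₃ → c₁ ~ c₂ → c₁ ~ c₃ → c₂ ~ c₃ →
        s ~ c₁ → s ≁ c₂ → s ≁ c₃ → ⊥
      singly-attached {a} Ta As Z₁ Z₂ Z₃ e₁₂ e₁₃ e₂₃ s~c₁ s≁c₂ s≁c₃ =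
        let b , Tb , b≢a , _ = another a a
            m , Tm , m≢a , m≢b = another a b
            open Corner Ta Tb Tm b≢a m≢a m≢b
        in exclude K₄-tail (_ , proj₁ Z₁ , at-Z Z₁ , _ , proj₁ Z₂ , (~-sym e₁₂ , at-Z Z₂) ,
          _ , proj₁ Z₃ , (~-sym e₂₃ , ~-sym e₁₃ , at-Z Z₃) , _ , proj₁ As , (s≁c₃ , s≁c₂ , s~c₁ , at-a As) , tt)

      open Cases singly-attached

      module _ {a b x x′ y} (cfg : Config a b x x′ y) where
        open Config cfg

        private
          module AtThird {m} (Tm : T m) (m≢a : m ≢ a) (m≢b : m ≢ b) where
            open Corner Ta Tb Tm b≢a m≢a m≢b public

            exclude-config : ∀ {ss} → Refuted false (K₄-config ss) → ¬ Realised ss (y ∷ x′ ∷ x ∷ ρ)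
            exclude-config ref r = exclude ref (x , proj₁ Ax , at-a Ax , x′ , proj₁ Ax′ , (~-sym x~x′ , at-a Ax′) ,
              y , proj₁ Ay , (y≁x′ , ~-sym x~y , at-b Ay) , r)

          module AnyThird = AtThird (proj₁ (proj₂ (another a b))) (proj₁ (proj₂ (proj₂ (another a b)))) (proj₂ (proj₂ (proj₂ (another a b))))

        dominating : ∀ {m v} → T m → m ≢ a → A m v → v ≁ x → v ≁ x′ → ⊥
        dominating {m} Tm m≢a Av v≁x v≁x′ with m ≟ b
        ... | yes refl = let open AnyThird in exclude-config K₄-undominated-b
          (_ , proj₁ Av , (v≁x′ , v≁x , at-b Av) , tt)
        ... | no m≢b = let open AtThird Tm m≢a m≢b in exclude-config K₄-undominated-m
          (_ , proj₁ Av , (v≁x′ , v≁x , at-m Av) , tt)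

        third : ∀ {u} → A a u → u ~ x → u ~ x′ → ⊥
        third Au u~x u~x′ = let open AnyThird in exclude-config K₄-third
          (_ , proj₁ Au , (u≁y , u~x′ , u~x , at-a Au) , tt)
          where
          u≁y = ¬~⇒≁ λ u~y → clash
            (common-nbrs u~x (proj₂ (proj₂ Au)) (proj₂ (proj₂ Ax)) u~y x~y (λ { refl → proj₁ (proj₂ Ay) Ta }))
            (≁-sym (A-far Tb Ay Ta (≢-sym b≢a)))

        separated : ∀ {m u v} → T m → m ≢ a → A a u → u ≁ x → u ≁ x′ → u ≁ y → A m v → v ~ x → v ~ u → ⊥
        separated {m} Tm m≢a Au u≁x u≁x′ u≁y Av v~x v~u with m ≟ b
        ... | yes refl = let open AnyThird in exclude-config K₄-crossing-b
          (_ , proj₁ Au , (u≁y , u≁x′ , u≁x , at-a Au) , _ , proj₁ Av , (v~u , v~x , at-b Av) , tt)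
        ... | no m≢b = let open AtThird Tm m≢a m≢b in exclude-config K₄-crossing-m
          (_ , proj₁ Au , (u≁y , u≁x′ , u≁x , at-a Au) , _ , proj₁ Av , (v~u , v~x , at-m Av) , tt)

        no-edge : ∀ {u v} → A a u → A a v → u ≁ x → u ≁ x′ → u ≁ y → v ≁ x → v ≁ x′ → v ≁ y → u ~ v → ⊥
        no-edge Au Av u≁x u≁x′ u≁y v≁x v≁x′ v≁y u~v = let open AnyThird in exclude-config K₄-edge
          (_ , proj₁ Au , (u≁y , u≁x′ , u≁x , at-a Au) , _ , proj₁ Av , (~-sym u~v , v≁y , v≁x′ , v≁x , at-a Av) , tt)

      -- Stated without a given `y`, whose part is played by `u`, so that it also applies with `x`
      -- and `x′` exchanged.
      no-triangle : ∀ {a x x′} → T a → A a x → A a x′ → x ~ x′ → ∀ {m l u v} → T m → T l → m ≢ a → l ≢ a → l ≢ m →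
        A m u → A l v → u ~ x → v ~ x → u ~ v → ⊥
      no-triangle Ta Ax Ax′ x~x′ Tm Tl m≢a l≢a l≢m Au Av u~x v~x u~v =
        let open Corner Ta Tm Tl m≢a l≢a l≢m
            u-cfg = record { Ta = Ta ; Tb = Tm ; b≢a = m≢a ; Ax = Ax ; Ax′ = Ax′ ; x~x′ = x~x′ ; Ay = Au ; x~y = ~-sym u~x }
            v-cfg = record { Ta = Ta ; Tb = Tl ; b≢a = l≢a ; Ax = Ax ; Ax′ = Ax′ ; x~x′ = x~x′ ; Ay = Av ; x~y = ~-sym v~x }
        in exclude K₄-triangle (_ , proj₁ Ax , at-a Ax , _ , proj₁ Ax′ , (~-sym x~x′ , at-a Ax′) ,
          _ , proj₁ Au , (Config.y≁x′ u-cfg , u~x , at-b Au) , _ , proj₁ Av , (~-sym u~v , Config.y≁x′ v-cfg , v~x , at-m Av) , tt)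

      contradiction : ⊥
      contradiction = not-all-independent λ Tt Au Av u~v →
        let b , x , x′ , y , cfg = config Tt Au Av u~v
            open Config cfg
        in Configured.contradiction cfg (dominating cfg) (no-triangle Ta Ax Ax′ x~x′) (no-triangle Ta Ax′ Ax (~-sym x~x′))
             (third cfg) (separated cfg) (no-edge cfg)

    -- The case of a missed triangle in the absence of K₄.

    module Triangle (3≤w : 3 ≤ w) {T : Pred V 0ℓ} (T? : Decidable T) (T⊆U : ∀ {v} → T v → U v)
      (T-clique : ∀ {s t} → T s → T t → s ≢ t → s ~ t)
      (T-maximal : ∀ {v s t} → U v → ¬ T v → T s → T t → s ≢ t → v ~ s → v ~ t → ⊥)
      (another : ∀ a b → ∃ λ c → T c × c ≢ a × c ≢ b)
      (no-K₄ : ∀ a b c d → U a → U b → U c → U d → a ~ b → a ~ c → a ~ d → b ~ c → b ~ d → c ~ d → ⊥)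
      (p₀ : V) (Up₀ : U p₀) (p₀-misses : ∀ t → T t → p₀ ≁ t) where

      open AroundClique 3≤w T? T⊆U T-clique T-maximal another
      open Engine true (const no-K₄)

      module Corner {a b m : V} (Ta : T a) (Tb : T b) (Tm : T m) (b≢a : b ≢ a) (m≢a : m ≢ a) (m≢b : m ≢ b) where
        ρ : Vec V 3
        ρ = m ∷ b ∷ a ∷ []

        exclude : ∀ {ss} → Refuted true (K₃-clique ss) → ¬ Realised ss ρ
        exclude ref r = refuted ref (a , T⊆U Ta , tt , b , T⊆U Tb , (T-clique Tb Ta b≢a , tt) ,
          m , T⊆U Tm , (T-clique Tm Tb m≢b , T-clique Tm Ta m≢a , tt) , r)

        at-a : ∀ {v} → A a v → Match (O ∷ O ∷ I ∷ []) (row v ρ)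
        at-a Av = A-far Ta Av Tm m≢a , A-far Ta Av Tb b≢a , proj₂ (proj₂ Av) , tt

        at-b : ∀ {v} → A b v → Match (O ∷ I ∷ O ∷ []) (row v ρ)
        at-b Av = A-far Tb Av Tm m≢b , proj₂ (proj₂ Av) , A-far Tb Av Ta (≢-sym b≢a) , tt

        at-m : ∀ {v} → A m v → Match (I ∷ O ∷ O ∷ []) (row v ρ)
        at-m Av = proj₂ (proj₂ Av) , A-far Tm Av Tb (≢-sym m≢b) , A-far Tm Av Ta (≢-sym m≢a) , tt

        at-Z : ∀ {v} → Z v → Match (O ∷ O ∷ O ∷ []) (row v ρ)
        at-Z (_ , v≁) = v≁ _ Tm , v≁ _ Tb , v≁ _ Ta , tt

      singly-attached : ∀ {a s c₁ c₂ c₃} → T a → A a s → Z c₁ → Z c₂ → Z c₃ → c₁ ~ c₂ → c₁ ~ c₃ → c₂ ~ c₃ →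
        s ~ c₁ → s ≁ c₂ → s ≁ c₃ → ⊥
      singly-attached {a} Ta As Z₁ Z₂ Z₃ e₁₂ e₁₃ e₂₃ s~c₁ s≁c₂ s≁c₃ =
        let b , Tb , b≢a , _ = another a a
            m , Tm , m≢a , m≢b = another a b
            open Corner Ta Tb Tm b≢a m≢a m≢b
        in exclude K₃-tail (_ , proj₁ Z₁ , at-Z Z₁ , _ , proj₁ Z₂ , (~-sym e₁₂ , at-Z Z₂) ,
          _ , proj₁ Z₃ , (~-sym e₂₃ , ~-sym e₁₃ , at-Z Z₃) , _ , proj₁ As , (s≁c₃ , s≁c₂ , s~c₁ , at-a As) , tt)

      open Cases singly-attached

      -- The edge `q p` comes from `attached`, applied to the component of `p₀` in `Z`; `p` may
      -- differ from `p₀`.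
      module Link {a₁ p q : V} (Ta₁ : T a₁) (Aq : A a₁ q) (Zp : Z p) (q~p : q ~ p) where

        module _ {a b x x′ y} (cfg : Config a b x x′ y) where
          open Config cfg

          private
            module AtThird {m} (Tm : T m) (m≢a : m ≢ a) (m≢b : m ≢ b) where
              open Corner Ta Tb Tm b≢a m≢a m≢b public

              exclude-config : ∀ {ss} → Refuted true (K₃-config ss) → ¬ Realised ss (y ∷ x′ ∷ x ∷ ρ)
              exclude-config ref r = exclude ref (x , proj₁ Ax , at-a Ax , x′ , proj₁ Ax′ , (~-sym x~x′ , at-a Ax′) ,
                y , proj₁ Ay , (y≁x′ , ~-sym x~y , at-b Ay) , r)

            module AnyThird = AtThird (proj₁ (proj₂ (another a b))) (proj₁ (proj₂ (proj₂ (another a b)))) (proj₂ (proj₂ (proj₂ (another a b))))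

          linked : p ~ x ⊎ (p ≁ x × p ~ x′)
          linked with p ~? x | p ~? x′ | p ~? y | a₁ ≟ a | a₁ ≟ b
          ... | yes p~x | _ | _ | _ | _ = inj₁ p~x
          ... | no p≁x | yes p~x′ | _ | _ | _ = inj₂ (¬~⇒≁ p≁x , p~x′)
          ... | no p≁x | no p≁x′ | yes p~y | _ | _ = ⊥-elim (let open AnyThird in exclude-config K₃-unlinked-y
            (p , proj₁ Zp , (p~y , ¬~⇒≁ p≁x′ , ¬~⇒≁ p≁x , at-Z Zp) , tt))
          ... | no p≁x | no p≁x′ | no p≁y | yes refl | _ = ⊥-elim (let open AnyThird in exclude-config K₃-unlinked-a
            (p , proj₁ Zp , (¬~⇒≁ p≁y , ¬~⇒≁ p≁x′ , ¬~⇒≁ p≁x , at-Z Zp) , q , proj₁ Aq , (q~p , at-a Aq) , tt))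
          ... | no p≁x | no p≁x′ | no p≁y | no _ | yes refl = ⊥-elim (let open AnyThird in exclude-config K₃-unlinked-b
            (p , proj₁ Zp , (¬~⇒≁ p≁y , ¬~⇒≁ p≁x′ , ¬~⇒≁ p≁x , at-Z Zp) , q , proj₁ Aq , (q~p , at-b Aq) , tt))
          ... | no p≁x | no p≁x′ | no p≁y | no a₁≢a | no a₁≢b = ⊥-elim (let open AtThird Ta₁ a₁≢a a₁≢b in exclude-config K₃-unlinked-m
            (p , proj₁ Zp , (¬~⇒≁ p≁y , ¬~⇒≁ p≁x′ , ¬~⇒≁ p≁x , at-Z Zp) , q , proj₁ Aq , (q~p , at-m Aq) , tt))

          dominating : ∀ {m v} → T m → m ≢ a → A m v → v ≁ x → v ≁ x′ → ⊥
          dominating {m} Tm m≢a Av v≁x v≁x′ with linked | m ≟ b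
          ... | inj₁ p~x | yes refl = let open AnyThird in exclude-config K₃-undominated-b-x
            (_ , proj₁ Av , (v≁x′ , v≁x , at-b Av) , p , proj₁ Zp , (p~x , at-Z Zp) , tt)
          ... | inj₂ (p≁x , p~x′) | yes refl = let open AnyThird in exclude-config K₃-undominated-b-x′
            (_ , proj₁ Av , (v≁x′ , v≁x , at-b Av) , p , proj₁ Zp , (p~x′ , p≁x , at-Z Zp) , tt)
          ... | inj₁ p~x | no m≢b = let open AtThird Tm m≢a m≢b in exclude-config K₃-undominated-m-x
            (_ , proj₁ Av , (v≁x′ , v≁x , at-m Av) , p , proj₁ Zp , (p~x , at-Z Zp) , tt)
          ... | inj₂ (p≁x , p~x′) | no m≢b = let open AtThird Tm m≢a m≢b in exclude-config K₃-undominated-m-x′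
            (_ , proj₁ Av , (v≁x′ , v≁x , at-m Av) , p , proj₁ Zp , (p~x′ , p≁x , at-Z Zp) , tt)

          third : ∀ {u} → A a u → u ~ x → u ~ x′ → ⊥
          third Au u~x u~x′ = no-K₄ a x x′ _ (T⊆U Ta) (proj₁ Ax) (proj₁ Ax′) (proj₁ Au)
            (~-sym (proj₂ (proj₂ Ax))) (~-sym (proj₂ (proj₂ Ax′))) (~-sym (proj₂ (proj₂ Au))) x~x′ (~-sym u~x) (~-sym u~x′)

          separated : ∀ {m u v} → T m → m ≢ a → A a u → u ≁ x → u ≁ x′ → u ≁ y → A m v → v ~ x → v ~ u → ⊥
          separated {m} Tm m≢a Au u≁x u≁x′ u≁y Av v~x v~u with linked | m ≟ b
          ... | inj₁ p~x | yes refl = let open AnyThird in exclude-config K₃-crossing-b-x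
            (_ , proj₁ Au , (u≁y , u≁x′ , u≁x , at-a Au) , _ , proj₁ Av , (v~u , v~x , at-b Av) , p , proj₁ Zp , (p~x , at-Z Zp) , tt)
          ... | inj₂ (p≁x , p~x′) | yes refl = let open AnyThird in exclude-config K₃-crossing-b-x′
            (_ , proj₁ Au , (u≁y , u≁x′ , u≁x , at-a Au) , _ , proj₁ Av , (v~u , v~x , at-b Av) , p , proj₁ Zp , (p~x′ , p≁x , at-Z Zp) , tt)
          ... | inj₁ p~x | no m≢b = let open AtThird Tm m≢a m≢b in exclude-config K₃-crossing-m-x
            (_ , proj₁ Au , (u≁y , u≁x′ , u≁x , at-a Au) , _ , proj₁ Av , (v~u , v~x , at-m Av) , p , proj₁ Zp , (p~x , at-Z Zp) , tt)
          ... | inj₂ (p≁x , p~x′) | no m≢b = let open AtThird Tm m≢a m≢b in exclude-config K₃-crossing-m-x′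
            (_ , proj₁ Au , (u≁y , u≁x′ , u≁x , at-a Au) , _ , proj₁ Av , (v~u , v~x , at-m Av) , p , proj₁ Zp , (p~x′ , p≁x , at-Z Zp) , tt)

          no-edge : ∀ {u v} → A a u → A a v → u ≁ x → u ≁ x′ → u ≁ y → v ≁ x → v ≁ x′ → v ≁ y → u ~ v → ⊥
          no-edge Au Av u≁x u≁x′ u≁y v≁x v≁x′ v≁y u~v with linked
          ... | inj₁ p~x = let open AnyThird in exclude-config K₃-edge-x (_ , proj₁ Au , (u≁y , u≁x′ , u≁x , at-a Au) ,
            _ , proj₁ Av , (~-sym u~v , v≁y , v≁x′ , v≁x , at-a Av) , p , proj₁ Zp , (p~x , at-Z Zp) , tt)
          ... | inj₂ (p≁x , p~x′) = let open AnyThird in exclude-config K₃-edge-x′ (_ , proj₁ Au , (u≁y , u≁x′ , u≁x , at-a Au) ,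
            _ , proj₁ Av , (~-sym u~v , v≁y , v≁x′ , v≁x , at-a Av) , p , proj₁ Zp , (p~x′ , p≁x , at-Z Zp) , tt)

        -- As `u` sees `x`, it can serve as the `y` of a configuration, which makes `linked`
        -- available for either order of `x` and `x′`.
        no-triangle : ∀ {a x x′} → T a → A a x → A a x′ → x ~ x′ → ∀ {m l u v} → T m → T l → m ≢ a → l ≢ a → l ≢ m →
          A m u → A l v → u ~ x → v ~ x → u ~ v → ⊥
        no-triangle {a} {x} {x′} Ta Ax Ax′ x~x′ {m} {l} {u} {v} Tm Tl m≢a l≢a l≢m Au Av u~x v~x u~v = cases (linked u-cfg)
          where
          u-cfg : Config a m x x′ u
          u-cfg = record { Ta = Ta ; Tb = Tm ; b≢a = m≢a ; Ax = Ax ; Ax′ = Ax′ ; x~x′ = x~x′ ; Ay = Au ; x~y = ~-sym u~x }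
          v-cfg : Config a l x x′ v
          v-cfg = record { Ta = Ta ; Tb = Tl ; b≢a = l≢a ; Ax = Ax ; Ax′ = Ax′ ; x~x′ = x~x′ ; Ay = Av ; x~y = ~-sym v~x }
          open Corner Ta Tm Tl m≢a l≢a l≢m
          cases : p ~ x ⊎ (p ≁ x × p ~ x′) → ⊥
          cases (inj₁ p~x) = exclude K₃-triangle-x (_ , proj₁ Ax , at-a Ax , _ , proj₁ Ax′ , (~-sym x~x′ , at-a Ax′) ,
            _ , proj₁ Au , (Config.y≁x′ u-cfg , u~x , at-b Au) , _ , proj₁ Av , (~-sym u~v , Config.y≁x′ v-cfg , v~x , at-m Av) ,
            p , proj₁ Zp , (p~x , at-Z Zp) , tt)
          cases (inj₂ (p≁x , p~x′)) = exclude K₃-triangle-x′ (_ , proj₁ Ax , at-a Ax , _ , proj₁ Ax′ , (~-sym x~x′ , at-a Ax′) ,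
            _ , proj₁ Au , (Config.y≁x′ u-cfg , u~x , at-b Au) , _ , proj₁ Av , (~-sym u~v , Config.y≁x′ v-cfg , v~x , at-m Av) ,
            p , proj₁ Zp , (p~x′ , p≁x , at-Z Zp) , tt)

      contradiction : ⊥
      contradiction = not-all-independent λ Tt Au Av u~v →
        let b , x , x′ , y , cfg = config Tt Au Av u~v
            open Config cfg
            C , _ = component Z? p₀ (Up₀ , p₀-misses)
            a₁ , q , p , Ta₁ , Aq , Kp , q~p = attached C
            open Link Ta₁ Aq (Component.K⊆ C p Kp) q~p
        in Configured.contradiction cfg (dominating cfg) (no-triangle Ta Ax Ax′ x~x′) (no-triangle Ta Ax′ Ax (~-sym x~x′))
             (third cfg) (separated cfg) (no-edge cfg)

    -- The neighbours that `u` has inside N(v) form a clique together with `u` and `v`. There are at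
    -- most `w − 2` of them, so greedy colouring succeeds.
    nbrs-col : ∀ v → U v → 3 ≤ w → Col (λ u → U u × u ~ v) (ℕ.pred w)
    nbrs-col v Uv (s≤s (s≤s _)) = greedy near? (const zero) λ u (Uu , u~v) →
      let both? = λ x → near? x ×-dec (x ~? u)
          both : ∀ {x} → x ∈ members both? → (U x × x ~ v) × x ~ u
          both = ∈-members⁻ both?
      in members both? ,
        s≤s⁻¹ (clique-bound (u ∷ v ∷ members both?) (Uu ∷ Uv ∷ All.tabulate (proj₁ ∘ proj₁ ∘ both))
          ((u~v ∷ All.tabulate (~-sym ∘ proj₂ ∘ both)) ∷ All.tabulate (~-sym ∘ proj₂ ∘ proj₁ ∘ both) ∷
            members-clique both? λ ((_ , a~v) , a~u) ((_ , b~v) , b~u) → common-nbrs u~v (~-sym a~u) (~-sym a~v) (~-sym b~u) (~-sym b~v))) ,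
        λ x (Ux , x~v) x~u → ∈-members⁺ both? ((Ux , x~v) , x~u)
      where
      near? : Decidable (λ u → U u × u ~ v)
      near? u = U? u ×-dec (u ~? v)

    -- The case distinction.

    K₄? : Dec (∃₂ λ a b → ∃₂ λ c d → U a × U b × U c × U d × a ~ b × a ~ c × a ~ d × b ~ c × b ~ d × c ~ d)
    K₄? = any? λ a → any? λ b → any? λ c → any? λ d → U? a ×-dec U? b ×-dec U? c ×-dec U? d ×-dec
      (a ~? b) ×-dec (a ~? c) ×-dec (a ~? d) ×-dec (b ~? c) ×-dec (b ~? d) ×-dec (c ~? d)

    missed-triangle? : Dec (∃₂ λ a b → ∃₂ λ c p → U a × U b × U c × U p × a ~ b × a ~ c × b ~ c × p ≁ a × p ≁ b × p ≁ c)
    missed-triangle? = any? λ a → any? λ b → any? λ c → any? λ p → U? a ×-dec U? b ×-dec U? c ×-dec U? p ×-dec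
      (a ~? b) ×-dec (a ~? c) ×-dec (b ~? c) ×-dec (p ≁? a) ×-dec (p ≁? b) ×-dec (p ≁? c)

    impossible : 3 ≤ w → ⊥
    impossible 3≤w with K₄?
    ... | yes (a , b , c , d , Ua , Ub , Uc , Ud , ab , ac , ad , bc , bd , cd) =
      LargeClique.contradiction 3≤w T? proj₁ T-clique T-maximal
        (avoid (a ∷ b ∷ c ∷ d ∷ []) ((ab ∷ ac ∷ ad ∷ []) ∷ (bc ∷ bd ∷ []) ∷ (cd ∷ []) ∷ [] ∷ [])
          ((Ua , inj₁ refl) ∷ (Ub , inj₂ (inj₁ refl)) ∷ (Uc , inj₂ (inj₂ (~-sym ac , ~-sym bc))) ∷ (Ud , inj₂ (inj₂ (~-sym ad , ~-sym bd))) ∷ []))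
      where
      open EdgeClique Ua Ub ab
    ... | no ¬K₄ with missed-triangle?
    ... | yes (a , b , c , p , Ua , Ub , Uc , Up , ab , ac , bc , p≁a , p≁b , p≁c) =
      Triangle.contradiction 3≤w T? proj₁ T-clique T-maximal
        (λ s t → let r , Tr , r∉ = three (s ∷ t ∷ []) (s≤s (s≤s (s≤s z≤n))) in r , Tr , r∉ ∘ here , r∉ ∘ there ∘ here)
        (λ a b c d Ua Ub Uc Ud ab ac ad bc bd cd → ¬K₄ (a , b , c , d , Ua , Ub , Uc , Ud , ab , ac , ad , bc , bd , cd))
        p Up missed
      where
      open EdgeClique Ua Ub ab
      three : ∀ L → length L < 3 → ∃ λ t → T t × t ∉ L
      three = avoid (a ∷ b ∷ c ∷ []) ((ab ∷ ac ∷ []) ∷ (bc ∷ []) ∷ [] ∷ [])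
          ((Ua , inj₁ refl) ∷ (Ub , inj₂ (inj₁ refl)) ∷ (Uc , inj₂ (inj₂ (~-sym ac , ~-sym bc))) ∷ [])
      missed : ∀ t → T t → p ≁ t
      missed t (_ , inj₁ refl) = p≁a
      missed t (_ , inj₂ (inj₁ refl)) = p≁b
      missed t (Ut , inj₂ (inj₂ (t~a , t~b))) with t ≟ c
      ... | yes refl = p≁c
      -- The maximal clique is exactly the triangle, since `t` would complete a K₄ with `a`, `b` and
      -- `c`.
      ... | no t≢c = ⊥-elim (¬K₄ (a , b , t , c , Ua , Ub , Ut , Uc , ab , ~-sym t~a , ac , ~-sym t~b , bc ,
        common-nbrs ab (~-sym t~a) (~-sym t~b) ac bc t≢c))
    impossible 3≤w | no ¬K₄ | no ¬missed with any? U?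
    ... | no empty = uncolourable ((λ _ → inject≤ zero (≤-trans 3≤w (m≤m+n w 3))) , λ {u} Uu _ _ _ → empty (u , Uu))
    -- `w − 1` colours for N(v) and four for the rest, which includes `v`, make `w + 3`. A triangle
    -- among the non-neighbours of `v` would be missed by `v`.
    ... | yes (v , Uv) = uncolourable (subst (Col U) (pred-shift 3≤w) (col-+ (λ u → U? u ×-dec (u ~? v))
      (λ u Uu ¬near → Uu , ¬~⇒≁ λ u~v → ¬near (Uu , u~v)) (nbrs-col v Uv 3≤w)
      (triangle-free-4-colourable (λ u → U? u ×-dec (u ≁? v)) λ (Ua , a≁v) (Ub , b≁v) (Uc , c≁v) ab ac bc →
        ¬missed (_ , _ , _ , v , Ua , Ub , Uc , Uv , ab , ac , bc , ≁-sym a≁v , ≁-sym b≁v , ≁-sym c≁v))))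
      where
      pred-shift : ∀ {k} → 3 ≤ k → ℕ.pred k + 4 ≡ k + 3
      pred-shift {suc k} _ = +-suc k 3

-- Induction on the vertex set.

module Theorem {n} (G : Graph n) (P₆-free : Free P6 G) (diamond-free : Free Diamond G) (w : ℕ)
  (bounded : ∀ k → HasClique G k → k ≤ w) where

  open Structure G P₆-free diamond-free
  open Clique G

  clique-bound : ∀ L → AllPairs _~_ L → length L ≤ w
  clique-bound L pairs = bounded (length L) (List.lookup L , pairwise-lookup pairs)

  -- The minimal counterexample in constructive form: if `col?` fails for `U`, the induction
  -- hypothesis colours all proper subsets, which is what `Critical` asks for.
  colourable : 3 ≤ w → ∀ m {U} (U? : Decidable U) → size U? ≤ m → Col U (w + 3)
  colourable 3≤w m U? bound with col? (w + 3) U?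
  ... | yes c = c
  colourable 3≤w zero U? bound | no ¬c = ⊥-elim (Minimal.Critical.impossible G P₆-free diamond-free U? w (λ L _ → clique-bound L)
    (λ {P} P? P⊆U x Ux ¬Px → ⊥-elim (n≮0 (≤-trans (size-< P? U? P⊆U x Ux ¬Px) bound))) ¬c 3≤w)
  colourable 3≤w (suc m) U? bound | no ¬c = ⊥-elim (Minimal.Critical.impossible G P₆-free diamond-free U? w (λ L _ → clique-bound L)
    (λ {P} P? P⊆U x Ux ¬Px → colourable 3≤w m P? (s≤s⁻¹ (≤-trans (size-< P? U? P⊆U x Ux ¬Px) bound))) ¬c 3≤w)

  everything : Col (λ _ → ⊤) (w + 3)
  everything with any? (λ a → any? λ b → any? λ c → (a ~? b) ×-dec (a ~? c) ×-dec (b ~? c))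
  ... | yes (a , b , c , ab , ac , bc) = colourable
    (clique-bound (a ∷ b ∷ c ∷ []) ((ab ∷ ac ∷ []) ∷ (bc ∷ []) ∷ [] ∷ [])) _ (λ _ → yes tt) ≤-refl
  ... | no none = below w clique-bound (triangle-free-4-colourable (λ _ → yes tt) λ _ _ _ ab ac bc → none (_ , _ , _ , ab , ac , bc))
    where
    below : ∀ w → (∀ L → AllPairs _~_ L → length L ≤ w) → Col (λ _ → ⊤) 4 → Col (λ _ → ⊤) (w + 3)
    below (suc w) _ = col-≤ (s≤s (m≤n+m 3 w))
    -- For `w = 0` four colours would be too many, but then there is no vertex: a single one is a
    -- clique.
    below zero bound _ = const zero , λ {u} _ _ _ _ → n≮0 (bound (u ∷ []) ([] ∷ []))

theorem4p1 : ∀ {n} (G : Graph n) → Free P6 G → Free Diamond G →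
    ∀ (w : ℕ) → CliqueNumber G w → ChromaticAtMost G (w + 3)
theorem4p1 G P₆-free diamond-free w (_ , bounded) =
  let c , proper = Theorem.everything G P₆-free diamond-free w bounded in c , λ _ _ → proper tt tt
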